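{- Let $n,w$ be integers with $w>3$ and $n>2w$, and let $b\in\{n-1,n,\dots,2n-1\}$. Then there is no equitable $2$-partition of the Johnson graph $J(n,w)$ with quotient matrix $\begin{pmatrix} w(n-w)-b & b\\ 2n-2-b & w(n-w)-2n+2+b\end{pmatrix}$.
   Context: The Johnson graph $J(n,w)$ has as vertices the binary vectors of length $n$ with exactly $w$ ones; two vertices are adjacent if they have exactly $w-1$ common ones. A partition $(C_1,C_2)$ of the vertex set of a graph is equitable with quotient matrix $S=(s_{ij})_{i,j\in\{1,2\}}$ if every vertex of $C_i$ has exactly $s_{ij}$ neighbours in $C_j$. -}

module Defs where

open import Data.Nat using (ℕ; zero; suc; _+_; _∸_)
open import Data.Bool using (Bool; true; false; _∧_; if_then_else_)
open import Data.Vec using (Vec; []; _∷_; zipWith)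
open import Data.List using (List; []; _∷_; map; _++_; filter; length)
open import Data.Product using (_×_; Σ; _,_)
open import Relation.Binary.PropositionalEquality using (_≡_)
open import Relation.Nullary using (Dec)
open import Data.Nat using (_≟_)
open import Data.Integer using (ℤ)
import Data.Integer
import Data.Bool

weight : ∀ {n} → Vec Bool n → ℕ
weight [] = 0
weight (true ∷ v) = suc (weight v)
weight (false ∷ v) = weight v

allVecs : (n : ℕ) → List (Vec Bool n)
allVecs zero = [] ∷ []
allVecs (suc n) = map (true ∷_) (allVecs n) ++ map (false ∷_) (allVecs n)

IsVertex : (n w : ℕ) → Vec Bool n → Set
IsVertex n w x = weight x ≡ w

common : ∀ {n} → Vec Bool n → Vec Bool n → ℕ
common x y = weight (zipWith _∧_ x y)

Adjacent : (n w : ℕ) → Vec Bool n → Vec Bool n → Set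
Adjacent n w x y = common x y ≡ w ∸ 1

-- A 2-partition (C₁ , C₂) of the vertex set is encoded by a colouring
-- c : Vec Bool n → Bool restricted to vertices: C₁ = {x | c x ≡ true},
-- C₂ = {x | c x ≡ false}.
-- The class index: true ↦ 1, false ↦ 2.

nbrsIn : (n w : ℕ) → (Vec Bool n → Bool) → Bool → Vec Bool n → ℕ
nbrsIn n w c col x =
  length (filter (λ y → weight y ≟ w) (filter (λ y → common x y ≟ (w ∸ 1))
    (filter (λ y → Data.Bool._≟_ (c y) col) (allVecs n))))

IsTwoPartition : (n w : ℕ) → (Vec Bool n → Bool) → Set
IsTwoPartition n w c =
  (Σ (Vec Bool n) λ x → IsVertex n w x × c x ≡ true) ×
  (Σ (Vec Bool n) λ x → IsVertex n w x × c x ≡ false)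

IsEquitable : (n w : ℕ) → (Vec Bool n → Bool) → (s₁₁ s₁₂ s₂₁ s₂₂ : ℤ) → Set
IsEquitable n w c s₁₁ s₁₂ s₂₁ s₂₂ =
  IsTwoPartition n w c ×
  (∀ x → IsVertex n w x → c x ≡ true →
     (Data.Integer.+_ (nbrsIn n w c true x) ≡ s₁₁) × (Data.Integer.+_ (nbrsIn n w c false x) ≡ s₁₂)) ×
  (∀ x → IsVertex n w x → c x ≡ false →
     (Data.Integer.+_ (nbrsIn n w c true x) ≡ s₂₁) × (Data.Integer.+_ (nbrsIn n w c false x) ≡ s₂₂))

{-# OPTIONS --safe #-}

-- Let F be the indicator of C₁, so that F is an eigenfunction of J(n,w) for the second eigenvalue, up to a
-- constant. Exchanging two coordinates gives a difference D(y) = F(10y) − F(01y), an eigenfunction of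
-- J(n−2,w−1) for the first eigenvalue, and a second exchange gives an eigenfunction of J(n−4,w−2) for its
-- degree, which is constant by the maximum principle. Hence D(y) = c + d·y, and the eigenvalue forces
-- (n−2) c = −(w−1) Σ d. Since |D| ≤ 1, three disjoint exchanges change D by at most 2, so all but four of the
-- d_i agree; as n − 2 > 2(w − 1), the balance equation leaves only D = 0 and D(y) = y_k − y_l.
--
-- In the second case F = 1 on ik*, jl* and F = 0 on il*, jk*, where i, j are the exchanged coordinates. For
-- p, q outside i, j, k, l the difference for p, q vanishes on these patterns, hence everywhere, so F depends
-- only on the trace S of its argument on {i,j,k,l}. The difference for i, p gives F_i = F_∅ (likewise j, k, l) and
-- (F_ij − F_j) + (F_ik − F_k) + (F_il − F_l) = 0, that is F_ij + 1 = 3 F_∅, impossible for bits.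
-- So every D is zero and F is constant.
module Submission where

open import Defs
import Data.Nat as ℕ
open import Data.Nat using (ℕ; zero; suc; _<_; _≤_; _∸_; z≤n; s≤s; _≡ᵇ_; _≟_)
import Data.Nat.Properties as ℕ
open import Data.Bool using (Bool; true; false; if_then_else_; T)
open import Data.Fin using (Fin; zero; suc)
open import Data.List using (List; []; _∷_; _++_; length; filter)
import Data.List as List
open import Data.Vec using (Vec; []; _∷_; replicate; head; map)
open import Data.Vec.Properties using (map-replicate)
open import Data.Vec.Relation.Unary.All using (All; []; _∷_)
import Data.Vec.Relation.Unary.All as All
open import Data.Integer using (ℤ; +_; -[1+_]; -_; _-_; _+_; _*_; 0ℤ; 1ℤ; -1ℤ; ∣_∣; +≤+; -≤+) renaming (_≤_ to _≤ᶻ_)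
import Data.Integer.Properties as ℤ
open import Data.Integer.Tactic.RingSolver using (solve-∀)
open import Data.Product using (_×_; _,_; ∃-syntax; proj₁; proj₂)
open import Data.Sum using (_⊎_; inj₁; inj₂)
open import Data.Empty using (⊥; ⊥-elim)
open import Function using (_∘_)
open import Relation.Nullary using (¬_; Dec; does)
open import Relation.Binary.PropositionalEquality

private variable
  n : ℕ
  X : Set

-- Neighbour sums

pattern t = true
pattern f = false

-- Sums of F over the vectors obtained from x by adding a one, removing a one, or moving a one.
up dn nb : (Vec Bool n → ℤ) → Vec Bool n → ℤ
up F []      = 0ℤ
up F (t ∷ x) = up (F ∘ (t ∷_)) x
up F (f ∷ x) = F (t ∷ x) + up (F ∘ (f ∷_)) x
dn F []      = 0ℤ
dn F (t ∷ x) = F (f ∷ x) + dn (F ∘ (t ∷_)) x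
dn F (f ∷ x) = dn (F ∘ (f ∷_)) x
nb F []      = 0ℤ
nb F (t ∷ x) = nb (F ∘ (t ∷_)) x + up (F ∘ (f ∷_)) x
nb F (f ∷ x) = nb (F ∘ (f ∷_)) x + dn (F ∘ (t ∷_)) x

up-cong : ∀ {F G : Vec Bool n → ℤ} x → (∀ y → weight y ≡ suc (weight x) → F y ≡ G y) → up F x ≡ up G x
up-cong []      e = refl
up-cong (t ∷ x) e = up-cong x (λ y h → e (t ∷ y) (cong suc h))
up-cong (f ∷ x) e = cong₂ _+_ (e (t ∷ x) refl) (up-cong x (λ y h → e (f ∷ y) h))

dn-cong : ∀ {F G : Vec Bool n → ℤ} x → (∀ y → suc (weight y) ≡ weight x → F y ≡ G y) → dn F x ≡ dn G x
dn-cong []      e = refl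
dn-cong (t ∷ x) e = cong₂ _+_ (e (f ∷ x) refl) (dn-cong x (λ y h → e (t ∷ y) (cong suc h)))
dn-cong (f ∷ x) e = dn-cong x (λ y h → e (f ∷ y) h)

nb-cong : ∀ {F G : Vec Bool n → ℤ} x → (∀ y → weight y ≡ weight x → F y ≡ G y) → nb F x ≡ nb G x
nb-cong []      e = refl
nb-cong (t ∷ x) e = cong₂ _+_ (nb-cong x (λ y h → e (t ∷ y) (cong suc h))) (up-cong x (λ y h → e (f ∷ y) h))
nb-cong (f ∷ x) e = cong₂ _+_ (nb-cong x (λ y h → e (f ∷ y) h)) (dn-cong x (λ y h → e (t ∷ y) h))

sub-exchange : ∀ a b c d → (a - b) + (c - d) ≡ (a + c) - (b + d)
sub-exchange = solve-∀

up-sub : ∀ (F G : Vec Bool n → ℤ) x → up (λ y → F y - G y) x ≡ up F x - up G x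
up-sub F G []      = refl
up-sub F G (t ∷ x) = up-sub _ _ x
up-sub F G (f ∷ x) = trans (cong₂ _+_ {x = F (t ∷ x) - G (t ∷ x)} refl (up-sub _ _ x)) (sub-exchange (F (t ∷ x)) (G (t ∷ x)) _ _)

dn-sub : ∀ (F G : Vec Bool n → ℤ) x → dn (λ y → F y - G y) x ≡ dn F x - dn G x
dn-sub F G []      = refl
dn-sub F G (t ∷ x) = trans (cong₂ _+_ {x = F (f ∷ x) - G (f ∷ x)} refl (dn-sub _ _ x)) (sub-exchange (F (f ∷ x)) (G (f ∷ x)) _ _)
dn-sub F G (f ∷ x) = dn-sub _ _ x

nb-sub : ∀ (F G : Vec Bool n → ℤ) x → nb (λ y → F y - G y) x ≡ nb F x - nb G x
nb-sub F G []      = refl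
nb-sub F G (t ∷ x) = trans (cong₂ _+_ (nb-sub _ _ x) (up-sub _ _ x)) (sub-exchange (nb (F ∘ (t ∷_)) x) _ _ _)
nb-sub F G (f ∷ x) = trans (cong₂ _+_ (nb-sub _ _ x) (dn-sub _ _ x)) (sub-exchange (nb (F ∘ (f ∷_)) x) _ _ _)

-- Affine functions on slices and their neighbour sums

val : Bool → ℤ
val t = 1ℤ
val f = 0ℤ

dot : Vec ℤ n → Vec Bool n → ℤ
dot []      []      = 0ℤ
dot (a ∷ d) (b ∷ x) = a * val b + dot d x

total sumsq : Vec ℤ n → ℤ
total []      = 0ℤ
total (a ∷ d) = a + total d
sumsq []      = 0ℤ
sumsq (a ∷ d) = a * a + sumsq d

drop-0 : ∀ c a s → c + (a * 0ℤ + s) ≡ c + s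
drop-0 = solve-∀

absorb-1 : ∀ c a s → c + (a * 1ℤ + s) ≡ c + a * 1ℤ + s
absorb-1 = solve-∀

-- Filling a zero adds its coefficient to the value, and the coefficients at the `n - weight x`
-- zeros sum to `total d - dot d x`. The constant `c` stays arbitrary so that the induction can
-- absorb the coefficient of a leading one into it.
up-affine : ∀ c (d : Vec ℤ n) x →
  up (λ y → c + dot d y) x ≡ (+ n - + weight x) * (c + dot d x) + (total d - dot d x)
up-affine c [] [] = sym (ℤ.+-identityʳ _)
up-affine {suc n} c (a ∷ d) (t ∷ x) = trans (up-cong x (λ y _ → absorb-1 c a (dot d y)))
  (trans (up-affine (c + a * 1ℤ) d x) (regroup c a (+ n) (+ weight x) (dot d x) (total d)))
  where
  regroup : ∀ c a n w s T → (n - w) * (c + a * 1ℤ + s) + (T - s) ≡ ((1ℤ + n) - (1ℤ + w)) * (c + (a * 1ℤ + s)) + ((a + T) - (a * 1ℤ + s))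
  regroup = solve-∀
up-affine {suc n} c (a ∷ d) (f ∷ x) = trans (cong₂ _+_ {x = c + dot (a ∷ d) (t ∷ x)} refl (trans (up-cong x (λ y _ → drop-0 c a (dot d y))) (up-affine c d x)))
  (regroup c a (+ n) (+ weight x) (dot d x) (total d))
  where
  regroup : ∀ c a n w s T → (c + (a * 1ℤ + s)) + ((n - w) * (c + s) + (T - s)) ≡ ((1ℤ + n) - w) * (c + (a * 0ℤ + s)) + ((a + T) - (a * 0ℤ + s))
  regroup = solve-∀

dn-affine : ∀ c (d : Vec ℤ n) x →
  dn (λ y → c + dot d y) x ≡ + weight x * (c + dot d x) - dot d x
dn-affine c [] [] = sym (ℤ.+-identityʳ _)
dn-affine {suc n} c (a ∷ d) (t ∷ x) = trans (cong₂ _+_ {x = c + dot (a ∷ d) (f ∷ x)} refl (trans (dn-cong x (λ y _ → absorb-1 c a (dot d y))) (dn-affine (c + a * 1ℤ) d x)))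
   (regroup c a (+ weight x) (dot d x))
  where
  regroup : ∀ c a w s → (c + (a * 0ℤ + s)) + (w * (c + a * 1ℤ + s) - s) ≡ (1ℤ + w) * (c + (a * 1ℤ + s)) - (a * 1ℤ + s)
  regroup = solve-∀
dn-affine {suc n} c (a ∷ d) (f ∷ x) = trans (trans (dn-cong x (λ y _ → drop-0 c a (dot d y))) (dn-affine c d x))
  (regroup c a (+ weight x) (dot d x))
  where
  regroup : ∀ c a w s → w * (c + s) - s ≡ w * (c + (a * 0ℤ + s)) - (a * 0ℤ + s)
  regroup = solve-∀

-- Moving a one from i to j changes the value by `d_j - d_i`. With w the weight, s the dot product
-- and T the total, the sum over all moves is `w (T - s) - (n - w) s = w T - n s`.
nb-affine : ∀ c (d : Vec ℤ n) x →
  nb (λ y → c + dot d y) x ≡ + weight x * (+ n - + weight x) * (c + dot d x) + (+ weight x * total d - + n * dot d x)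
nb-affine c [] [] = refl
nb-affine {suc n} c (a ∷ d) (t ∷ x) =
  trans (cong₂ _+_ (trans (nb-cong x (λ y _ → absorb-1 c a (dot d y))) (nb-affine (c + a * 1ℤ) d x))
                   (trans (up-cong x (λ y _ → drop-0 c a (dot d y))) (up-affine c d x)))
    (regroup c a (+ n) (+ weight x) (dot d x) (total d))
  where
  regroup : ∀ c a n w s T →
    w * (n - w) * (c + a * 1ℤ + s) + (w * T - n * s) + ((n - w) * (c + s) + (T - s))
    ≡ (1ℤ + w) * ((1ℤ + n) - (1ℤ + w)) * (c + (a * 1ℤ + s)) + ((1ℤ + w) * (a + T) - (1ℤ + n) * (a * 1ℤ + s))
  regroup = solve-∀
nb-affine {suc n} c (a ∷ d) (f ∷ x) =
  trans (cong₂ _+_ (trans (nb-cong x (λ y _ → drop-0 c a (dot d y))) (nb-affine c d x))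
                   (trans (dn-cong x (λ y _ → absorb-1 c a (dot d y))) (dn-affine (c + a * 1ℤ) d x)))
    (regroup c a (+ n) (+ weight x) (dot d x) (total d))
  where
  regroup : ∀ c a n w s T →
    w * (n - w) * (c + s) + (w * T - n * s) + (w * (c + a * 1ℤ + s) - s)
    ≡ w * ((1ℤ + n) - w) * (c + (a * 0ℤ + s)) + (w * (a + T) - (1ℤ + n) * (a * 0ℤ + s))
  regroup = solve-∀

total-replicate : ∀ n r → total (replicate n r) ≡ + n * r
total-replicate zero    r = sym (ℤ.*-zeroˡ r)
total-replicate (suc n) r = trans (cong (λ s → r + s) (total-replicate n r)) (expand (+ n) r)
  where
  expand : ∀ n r → r + n * r ≡ (1ℤ + n) * r
  expand = solve-∀

dot-replicate-0 : ∀ (y : Vec Bool n) → dot (replicate n 0ℤ) y ≡ 0ℤ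
dot-replicate-0 []      = refl
dot-replicate-0 (t ∷ y) = trans (ℤ.+-identityˡ _) (dot-replicate-0 y)
dot-replicate-0 (f ∷ y) = trans (ℤ.+-identityˡ _) (dot-replicate-0 y)

-- Coordinate permutations and the maximum principle

-- Permutations as words in transpositions of neighbouring coordinates. One word acts on
-- coefficients and on bit vectors alike, and an invariance needs a real check only at `swp`.
data Perm : ℕ → Set where
  idp  : Perm n
  swp  : Perm (suc (suc n))
  lift : Perm n → Perm (suc n)
  _⊙_  : Perm n → Perm n → Perm n

infixr 9 _⊙_

act : Perm n → Vec X n → Vec X n
act idp      x           = x
act swp      (a ∷ b ∷ x) = b ∷ a ∷ x
act (lift π) (a ∷ x)     = a ∷ act π x
act (π ⊙ ρ)  x           = act π (act ρ x)

inv : Perm n → Perm n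
inv idp      = idp
inv swp      = swp
inv (lift π) = lift (inv π)
inv (π ⊙ ρ)  = inv ρ ⊙ inv π

act-inv : ∀ (π : Perm n) (x : Vec X n) → act π (act (inv π) x) ≡ x
act-inv idp      x           = refl
act-inv swp      (a ∷ b ∷ x) = refl
act-inv (lift π) (a ∷ x)     = cong (a ∷_) (act-inv π x)
act-inv (π ⊙ ρ)  x           = trans (cong (act π) (act-inv ρ _)) (act-inv π x)

weight-act : ∀ (π : Perm n) x → weight (act π x) ≡ weight x
weight-act idp      x           = refl
weight-act swp      (t ∷ t ∷ x) = refl
weight-act swp      (t ∷ f ∷ x) = refl
weight-act swp      (f ∷ t ∷ x) = refl
weight-act swp      (f ∷ f ∷ x) = refl
weight-act (lift π) (t ∷ x)     = cong suc (weight-act π x)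
weight-act (lift π) (f ∷ x)     = weight-act π x
weight-act (π ⊙ ρ)  x           = trans (weight-act π _) (weight-act ρ x)

swap-left : ∀ a b c → a + (b + c) ≡ b + (a + c)
swap-left = solve-∀

swap-right : ∀ a b c → a + b + c ≡ a + c + b
swap-right = solve-∀

swap-outer : ∀ a b c d → a + b + (c + d) ≡ a + d + (c + b)
swap-outer = solve-∀

dot-act : ∀ (π : Perm n) d x → dot (act π d) (act π x) ≡ dot d x
dot-act idp      d           x           = refl
dot-act swp      (a ∷ b ∷ d) (p ∷ q ∷ x) = swap-left (b * val q) (a * val p) (dot d x)
dot-act (lift π) (a ∷ d)     (p ∷ x)     = cong (λ s → a * val p + s) (dot-act π d x)
dot-act (π ⊙ ρ)  d           x           = trans (dot-act π _ _) (dot-act ρ d x)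

total-act : ∀ (π : Perm n) d → total (act π d) ≡ total d
total-act idp      d           = refl
total-act swp      (a ∷ b ∷ d) = swap-left b a (total d)
total-act (lift π) (a ∷ d)     = cong (λ s → a + s) (total-act π d)
total-act (π ⊙ ρ)  d           = trans (total-act π _) (total-act ρ d)

sumsq-act : ∀ (π : Perm n) d → sumsq (act π d) ≡ sumsq d
sumsq-act idp      d           = refl
sumsq-act swp      (a ∷ b ∷ d) = swap-left (b * b) (a * a) (sumsq d)
sumsq-act (lift π) (a ∷ d)     = cong (λ s → a * a + s) (sumsq-act π d)
sumsq-act (π ⊙ ρ)  d           = trans (sumsq-act π _) (sumsq-act ρ d)

all-act : ∀ {P : ℤ → Set} (π : Perm n) {d} → All P d → All P (act π d)
all-act idp      ps           = ps
all-act swp      (p ∷ q ∷ ps) = q ∷ p ∷ ps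
all-act (lift π) (p ∷ ps)     = p ∷ all-act π ps
all-act (π ⊙ ρ)  ps           = all-act π (all-act ρ ps)

up-act : ∀ (F : Vec Bool n → ℤ) π x → up (F ∘ act π) x ≡ up F (act π x)
up-act F idp      x           = refl
up-act F swp      (t ∷ t ∷ x) = refl
up-act F swp      (t ∷ f ∷ x) = refl
up-act F swp      (f ∷ t ∷ x) = refl
up-act F swp      (f ∷ f ∷ x) = swap-left (F (f ∷ t ∷ x)) (F (t ∷ f ∷ x)) _
up-act F (lift π) (t ∷ x)     = up-act _ π x
up-act F (lift π) (f ∷ x)     = cong (λ s → F (t ∷ act π x) + s) (up-act _ π x)
up-act F (π ⊙ ρ)  x           = trans (up-act _ ρ x) (up-act F π _)

dn-act : ∀ (F : Vec Bool n → ℤ) π x → dn (F ∘ act π) x ≡ dn F (act π x)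
dn-act F idp      x           = refl
dn-act F swp      (t ∷ t ∷ x) = swap-left (F (t ∷ f ∷ x)) (F (f ∷ t ∷ x)) _
dn-act F swp      (t ∷ f ∷ x) = refl
dn-act F swp      (f ∷ t ∷ x) = refl
dn-act F swp      (f ∷ f ∷ x) = refl
dn-act F (lift π) (t ∷ x)     = cong (λ s → F (f ∷ act π x) + s) (dn-act _ π x)
dn-act F (lift π) (f ∷ x)     = dn-act _ π x
dn-act F (π ⊙ ρ)  x           = trans (dn-act _ ρ x) (dn-act F π _)

-- Relabelling coordinates is an automorphism of the Johnson graph. At `swp` the same summands
-- appear in another order.
nb-act : ∀ (F : Vec Bool n → ℤ) π x → nb (F ∘ act π) x ≡ nb F (act π x)
nb-act F idp      x           = refl
nb-act F swp      (t ∷ t ∷ x) =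
  swap-right (nb (λ y → F (t ∷ t ∷ y)) x) (up (λ y → F (f ∷ t ∷ y)) x) (up (λ y → F (t ∷ f ∷ y)) x)
nb-act F swp      (t ∷ f ∷ x) =
  swap-outer (nb (λ y → F (f ∷ t ∷ y)) x) (dn (λ y → F (t ∷ t ∷ y)) x) (F (t ∷ f ∷ x)) (up (λ y → F (f ∷ f ∷ y)) x)
nb-act F swp      (f ∷ t ∷ x) =
  swap-outer (nb (λ y → F (t ∷ f ∷ y)) x) (up (λ y → F (f ∷ f ∷ y)) x) (F (f ∷ t ∷ x)) (dn (λ y → F (t ∷ t ∷ y)) x)
nb-act F swp      (f ∷ f ∷ x) =
  swap-right (nb (λ y → F (f ∷ f ∷ y)) x) (dn (λ y → F (t ∷ f ∷ y)) x) (dn (λ y → F (f ∷ t ∷ y)) x)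
nb-act F (lift π) (t ∷ x)     = cong₂ _+_ (nb-act _ π x) (up-act _ π x)
nb-act F (lift π) (f ∷ x)     = cong₂ _+_ (nb-act _ π x) (dn-act _ π x)
nb-act F (π ⊙ ρ)  x           = trans (nb-act _ ρ x) (nb-act F π _)

-- A one moves from position `k` to the next position. The index `k` is recorded because later the
-- change of a function along such a move depends on `k` alone.
data Adj : Fin n → Vec Bool (suc n) → Vec Bool (suc n) → Set where
  here  : ∀ {z : Vec Bool n} → Adj zero (t ∷ f ∷ z) (f ∷ t ∷ z)
  there : ∀ {k : Fin n} {x y} b → Adj k x y → Adj (suc k) (b ∷ x) (b ∷ y)

adj-weight : ∀ {k : Fin n} {x y} → Adj k x y → weight x ≡ weight y
adj-weight here        = refl
adj-weight (there t a) = cong suc (adj-weight a)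
adj-weight (there f a) = adj-weight a

rotate : Perm (suc (suc (suc n)))
rotate = swp ⊙ lift swp

-- Carries the first two coordinates to positions `k` and `k + 1`, so that every `Adj` move becomes
-- an exchange of the two leading coordinates. `rotate` brings the third coordinate to the front.
toPos : Fin (suc n) → Perm (suc (suc n))
toPos zero            = idp
toPos {suc n} (suc k) = lift (toPos k) ⊙ rotate

adj-split : ∀ {k : Fin (suc n)} {x y} → Adj k x y →
  ∃[ z ] x ≡ act (toPos k) (t ∷ f ∷ z) × y ≡ act (toPos k) (f ∷ t ∷ z)
adj-split (here {z = z}) = z , refl , refl
adj-split {n = suc n} (there b a) with z , p , q ← adj-split a = b ∷ z , cong (b ∷_) p , cong (b ∷_) q

vertex : ∀ {v} → v ≤ n → ∃[ x ] weight {n} x ≡ v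
vertex {zero}  z≤n       = [] , refl
vertex {suc n} z≤n       with x , p ← vertex {n} z≤n = f ∷ x , p
vertex         (s≤s v≤n) with x , p ← vertex v≤n     = t ∷ x , cong suc p

weight≤ : ∀ (x : Vec Bool n) → weight x ≤ n
weight≤ []      = z≤n
weight≤ (t ∷ x) = s≤s (weight≤ x)
weight≤ (f ∷ x) = ℕ.m≤n⇒m≤1+n (weight≤ x)

-- Connectivity of a slice under `Adj` moves, phrased as transport of a predicate instead of by
-- paths. Both directions are assumed because `Adj` is oriented.
connected : ∀ (P : Vec Bool (suc n) → Set) →
  (∀ {k x y} → Adj k x y → P x → P y) → (∀ {k x y} → Adj k x y → P y → P x) →
  ∀ x y → weight x ≡ weight y → P x → P y
connected {zero} P fw bw (t ∷ []) (t ∷ []) e px = px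
connected {zero} P fw bw (f ∷ []) (f ∷ []) e px = px
connected {suc n} P fw bw (t ∷ x) (t ∷ y) e px =
  connected (P ∘ (t ∷_)) (λ a → fw (there t a)) (λ a → bw (there t a)) x y (ℕ.suc-injective e) px
connected {suc n} P fw bw (f ∷ x) (f ∷ y) e px =
  connected (P ∘ (f ∷_)) (λ a → fw (there f a)) (λ a → bw (there f a)) x y e px
connected {suc n} P fw bw (t ∷ x) (f ∷ y) e px =
  -- The heads differ, so the route passes through `t ∷ f ∷ z` and `f ∷ t ∷ z`. Such a `z` exists
  -- since `suc (weight x) = weight y` is at most `suc n`.
  let z , p = vertex {n} {weight x} (ℕ.≤-pred (subst (_≤ suc n) (sym e) (weight≤ y)))
  in connected (P ∘ (f ∷_)) (λ a → fw (there f a)) (λ a → bw (there f a)) (t ∷ z) y (trans (cong suc p) e)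
       (fw here (connected (P ∘ (t ∷_)) (λ a → fw (there t a)) (λ a → bw (there t a)) x (f ∷ z) (sym p) px))
connected {suc n} P fw bw (f ∷ x) (t ∷ y) e px =
  let z , p = vertex {n} {weight y} (ℕ.≤-pred (subst (_≤ suc n) e (weight≤ x)))
  in connected (P ∘ (t ∷_)) (λ a → fw (there t a)) (λ a → bw (there t a)) (f ∷ z) y p
       (bw here (connected (P ∘ (f ∷_)) (λ a → fw (there f a)) (λ a → bw (there f a)) x (t ∷ z) (trans e (cong suc (sym p))) px))

slice-constant : ∀ (G : Vec Bool (suc n) → ℤ) v → (∀ {k x y} → Adj k x y → weight x ≡ v → G x ≡ G y) →
  ∀ x y → weight x ≡ v → weight y ≡ v → G x ≡ G y
slice-constant G v inv x y p q = proj₂ (connected (λ y → weight y ≡ v × G x ≡ G y)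
  (λ a (r , e) → trans (sym (adj-weight a)) r , trans e (inv a r))
  (λ a (r , e) → trans (adj-weight a) r , trans e (sym (inv a (trans (adj-weight a) r))))
  x y (trans p (sym q)) (p , refl))

-- Nonnegative functions with vanishing neighbour sum

sum-nonneg : ∀ {a b} → 0ℤ ≤ᶻ a → 0ℤ ≤ᶻ b → 0ℤ ≤ᶻ a + b
sum-nonneg = ℤ.+-mono-≤

sum-zeroˡ : ∀ {a b} → 0ℤ ≤ᶻ a → 0ℤ ≤ᶻ b → a + b ≡ 0ℤ → a ≡ 0ℤ
sum-zeroˡ {a} {b} p q e = ℤ.≤-antisym
  (subst (a ≤ᶻ_) e (subst (_≤ᶻ a + b) (ℤ.+-identityʳ a) (ℤ.+-monoʳ-≤ a q))) p

sum-zeroʳ : ∀ {a b} → 0ℤ ≤ᶻ a → 0ℤ ≤ᶻ b → a + b ≡ 0ℤ → b ≡ 0ℤ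
sum-zeroʳ {a} {b} p q e = sum-zeroˡ q p (trans (ℤ.+-comm b a) e)

up-nonneg : ∀ {H : Vec Bool n → ℤ} x → (∀ y → weight y ≡ suc (weight x) → 0ℤ ≤ᶻ H y) → 0ℤ ≤ᶻ up H x
up-nonneg []      h = ℤ.≤-refl
up-nonneg (t ∷ x) h = up-nonneg x (λ y e → h (t ∷ y) (cong suc e))
up-nonneg (f ∷ x) h = sum-nonneg (h (t ∷ x) refl) (up-nonneg x (λ y e → h (f ∷ y) e))

dn-nonneg : ∀ {H : Vec Bool n → ℤ} x → (∀ y → suc (weight y) ≡ weight x → 0ℤ ≤ᶻ H y) → 0ℤ ≤ᶻ dn H x
dn-nonneg []      h = ℤ.≤-refl
dn-nonneg (t ∷ x) h = sum-nonneg (h (f ∷ x) refl) (dn-nonneg x (λ y e → h (t ∷ y) (cong suc e)))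
dn-nonneg (f ∷ x) h = dn-nonneg x (λ y e → h (f ∷ y) e)

nb-nonneg : ∀ {H : Vec Bool n → ℤ} x → (∀ y → weight y ≡ weight x → 0ℤ ≤ᶻ H y) → 0ℤ ≤ᶻ nb H x
nb-nonneg []      h = ℤ.≤-refl
nb-nonneg (t ∷ x) h = sum-nonneg (nb-nonneg x (λ y e → h (t ∷ y) (cong suc e))) (up-nonneg x (λ y e → h (f ∷ y) e))
nb-nonneg (f ∷ x) h = sum-nonneg (nb-nonneg x (λ y e → h (f ∷ y) e)) (dn-nonneg x (λ y e → h (t ∷ y) e))

-- `H y` is one of the nonnegative summands of `nb H x`, and these can add up to zero only if each
-- is zero.
nb-zero-fw : ∀ (H : Vec Bool (suc n) → ℤ) {k x y} → Adj k x y →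
  (∀ y → weight y ≡ weight x → 0ℤ ≤ᶻ H y) → nb H x ≡ 0ℤ → H y ≡ 0ℤ
nb-zero-fw H (here {z = z}) h e =
  sum-zeroˡ (h (f ∷ t ∷ z) refl) (up-nonneg z (λ y e → h (f ∷ f ∷ y) e))
    (sum-zeroʳ (nb-nonneg (f ∷ z) (λ y e → h (t ∷ y) (cong suc e)))
               (up-nonneg (f ∷ z) (λ y e → h (f ∷ y) e)) e)
nb-zero-fw H {x = _ ∷ x} (there t a) h e = nb-zero-fw (H ∘ (t ∷_)) a (λ y e → h (t ∷ y) (cong suc e))
  (sum-zeroˡ (nb-nonneg x (λ y e → h (t ∷ y) (cong suc e))) (up-nonneg x (λ y e → h (f ∷ y) e)) e)
nb-zero-fw H {x = _ ∷ x} (there f a) h e = nb-zero-fw (H ∘ (f ∷_)) a (λ y e → h (f ∷ y) e)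
  (sum-zeroˡ (nb-nonneg x (λ y e → h (f ∷ y) e)) (dn-nonneg x (λ y e → h (t ∷ y) e)) e)

nb-zero-bw : ∀ (H : Vec Bool (suc n) → ℤ) {k x y} → Adj k x y →
  (∀ x → weight x ≡ weight y → 0ℤ ≤ᶻ H x) → nb H y ≡ 0ℤ → H x ≡ 0ℤ
nb-zero-bw H (here {z = z}) h e =
  sum-zeroˡ (h (t ∷ f ∷ z) refl) (dn-nonneg z (λ y e → h (t ∷ t ∷ y) (cong suc e)))
    (sum-zeroʳ (nb-nonneg (t ∷ z) (λ y e → h (f ∷ y) e))
               (dn-nonneg (t ∷ z) (λ y e → h (t ∷ y) e)) e)
nb-zero-bw H {y = _ ∷ x} (there t a) h e = nb-zero-bw (H ∘ (t ∷_)) a (λ y e → h (t ∷ y) (cong suc e))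
  (sum-zeroˡ (nb-nonneg x (λ y e → h (t ∷ y) (cong suc e))) (up-nonneg x (λ y e → h (f ∷ y) e)) e)
nb-zero-bw H {y = _ ∷ x} (there f a) h e = nb-zero-bw (H ∘ (f ∷_)) a (λ y e → h (f ∷ y) e)
  (sum-zeroˡ (nb-nonneg x (λ y e → h (f ∷ y) e)) (dn-nonneg x (λ y e → h (t ∷ y) e)) e)

argmax : ∀ v (G : Vec Bool n → ℤ) →
  (∀ (x : Vec Bool n) → ¬ weight x ≡ v) ⊎ (∃[ m ] weight m ≡ v × (∀ x → weight x ≡ v → G x ≤ᶻ G m))
argmax {zero} zero    G = inj₂ ([] , refl , λ { [] _ → ℤ.≤-refl })
argmax {zero} (suc v) G = inj₁ λ { [] () }
argmax {suc n} zero G with argmax zero (G ∘ (f ∷_))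
... | inj₁ no           = inj₁ λ { (t ∷ x) () ; (f ∷ x) → no x }
... | inj₂ (m , p , mx) = inj₂ (f ∷ m , p , λ { (t ∷ x) () ; (f ∷ x) → mx x })
argmax {suc n} (suc v) G with argmax v (G ∘ (t ∷_)) | argmax (suc v) (G ∘ (f ∷_))
... | inj₁ no           | inj₁ no'             = inj₁ λ { (t ∷ x) e → no x (ℕ.suc-injective e) ; (f ∷ x) → no' x }
... | inj₁ no           | inj₂ (m , p , mx)    =
  inj₂ (f ∷ m , p , λ { (t ∷ x) e → ⊥-elim (no x (ℕ.suc-injective e)) ; (f ∷ x) → mx x })
... | inj₂ (m , p , mx) | inj₁ no              =
  inj₂ (t ∷ m , cong suc p , λ { (t ∷ x) e → mx x (ℕ.suc-injective e) ; (f ∷ x) e → ⊥-elim (no x e) })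
... | inj₂ (m , p , mx) | inj₂ (m' , p' , mx') with ℤ.≤-total (G (t ∷ m)) (G (f ∷ m'))
...   | inj₁ le = inj₂ (f ∷ m' , p' , λ { (t ∷ x) e → ℤ.≤-trans (mx x (ℕ.suc-injective e)) le ; (f ∷ x) → mx' x })
...   | inj₂ le = inj₂ (t ∷ m , cong suc p , λ { (t ∷ x) e → mx x (ℕ.suc-injective e) ; (f ∷ x) e → ℤ.≤-trans (mx' x e) le })

nb-const : ∀ c (x : Vec Bool n) → nb (λ _ → c) x ≡ + weight x * (+ n - + weight x) * c
nb-const {n} c x = begin
  nb (λ _ → c) x                 ≡⟨ nb-cong x (λ y _ → sym (zeros y)) ⟩
  nb (λ y → c + dot 𝟎 y) x       ≡⟨ nb-affine c 𝟎 x ⟩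
  _                              ≡⟨ cong₂ (λ a b → + weight x * (+ n - + weight x) * a + (+ weight x * b - + n * dot 𝟎 x)) (zeros x) (trans (total-replicate n 0ℤ) (ℤ.*-zeroʳ (+ n))) ⟩
  _                              ≡⟨ cong (λ a → + weight x * (+ n - + weight x) * c + (+ weight x * 0ℤ - + n * a)) (dot-replicate-0 x) ⟩
  _                              ≡⟨ simp (+ weight x) (+ n) c ⟩
  + weight x * (+ n - + weight x) * c ∎
  where
  open ≡-Reasoning
  𝟎 : Vec ℤ n
  𝟎 = replicate n 0ℤ
  zeros : ∀ (y : Vec Bool n) → c + dot 𝟎 y ≡ c
  zeros y = trans (cong (λ s → c + s) (dot-replicate-0 y)) (ℤ.+-identityʳ c)
  simp : ∀ w n c → w * (n - w) * c + (w * 0ℤ - n * 0ℤ) ≡ w * (n - w) * c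
  simp = solve-∀

-- Maximum principle: at a maximum of G the neighbour average equals G, so all neighbours are maxima.
harmonic-constant : ∀ v (G : Vec Bool (suc n) → ℤ) →
  (∀ x → weight x ≡ v → nb G x ≡ + v * (+ suc n - + v) * G x) →
  ∀ x y → weight x ≡ v → weight y ≡ v → G x ≡ G y
harmonic-constant {n} v G harm x y p q with argmax v G
... | inj₁ no            = ⊥-elim (no x p)
... | inj₂ (m , pm , mx) = trans (sym (all-max x p)) (all-max y q)
  where
  -- The deficit below the maximum. It is nonnegative on the slice, and its neighbour sum vanishes
  -- wherever it vanishes, so its zeros spread along `Adj` moves.
  H : Vec Bool (suc n) → ℤ
  H x = G m - G x

  H≥0 : ∀ x → weight x ≡ v → 0ℤ ≤ᶻ H x
  H≥0 x e = ℤ.i≤j⇒0≤j-i (mx x e)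

  nbH : ∀ x → weight x ≡ v → H x ≡ 0ℤ → nb H x ≡ 0ℤ
  nbH x refl h = begin
    nb H x                                        ≡⟨ nb-sub (λ _ → G m) G x ⟩
    nb (λ _ → G m) x - nb G x                     ≡⟨ cong₂ _-_ (nb-const (G m) x) (harm x refl) ⟩
    deg * G m - deg * G x                         ≡⟨ factor deg (G m) (G x) ⟩
    deg * H x                                     ≡⟨ cong (deg *_) h ⟩
    deg * 0ℤ                                      ≡⟨ ℤ.*-zeroʳ deg ⟩
    0ℤ                                            ∎
    where
    open ≡-Reasoning
    deg = + weight x * (+ suc n - + weight x)
    factor : ∀ d a b → d * a - d * b ≡ d * (a - b)
    factor = solve-∀

  all-max : ∀ x → weight x ≡ v → G m ≡ G x
  all-max x p = ℤ.i-j≡0⇒i≡j _ _ (proj₂ (connected (λ y → weight y ≡ v × H y ≡ 0ℤ)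
    (λ {k} {x} a (r , h) → trans (sym (adj-weight a)) r ,
        nb-zero-fw H a (λ y e → H≥0 y (trans e r)) (nbH x r h))
    (λ {k} {x} {y} a (r , h) → trans (adj-weight a) r ,
        nb-zero-bw H a (λ y e → H≥0 y (trans e r)) (nbH y r h))
    m x (trans pm (sym p)) (pm , ℤ.+-inverseʳ (G m))))

-- Differences of eigenfunctions

-- Coefficients with last entry 0 and consecutive differences `d_k - d_(k+1) = e k`: a linear
-- function with prescribed change along each `Adj` move.
potential : (Fin n → ℤ) → Vec ℤ (suc n)
potential {zero}  e = 0ℤ ∷ []
potential {suc n} e = (e zero + head (potential (e ∘ suc))) ∷ potential (e ∘ suc)

dot-potential : ∀ (e : Fin n → ℤ) {k x y} → Adj k x y → dot (potential e) x - dot (potential e) y ≡ e k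
dot-potential e (here {z = z}) with potential (e ∘ suc)
... | a ∷ d = simp (e zero) a (dot d z)
  where
  simp : ∀ e a s → (e + a) * 1ℤ + (a * 0ℤ + s) - ((e + a) * 0ℤ + (a * 1ℤ + s)) ≡ e
  simp = solve-∀
dot-potential e {x = _ ∷ x} {y = _ ∷ y} (there b a) =
  trans (cancel (head (potential e) * val b) (dot (potential (e ∘ suc)) x) (dot (potential (e ∘ suc)) y)) (dot-potential (e ∘ suc) a)
  where
  cancel : ∀ a s r → a + s - (a + r) ≡ s - r
  cancel = solve-∀

-- `G` and the linear function of `potential e` change equally along every `Adj` move, so their
-- difference is constant on the slice. The constant `c` is its value at `x₀`.
affine : ∀ v (G : Vec Bool (suc n) → ℤ) (e : Fin n → ℤ) →
  (∀ {k x y} → Adj k x y → weight x ≡ v → G x - G y ≡ e k) → v ≤ suc n →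
  ∃[ c ] ∃[ d ] (∀ x → weight x ≡ v → G x ≡ c + dot d x)
affine {n} v G e h v≤ = c , d , λ x p → trans (split (G x) (dot d x)) (cong (_+ dot d x) (const x x₀ p p₀))
  where
  d = potential e
  x₀ = proj₁ (vertex v≤)
  p₀ = proj₂ (vertex v≤)
  c = G x₀ - dot d x₀
  split : ∀ a s → a ≡ a - s + s
  split = solve-∀
  regroup : ∀ a b s r → a - s ≡ (a - b) - (s - r) + (b - r)
  regroup = solve-∀
  const : ∀ x y → weight x ≡ v → weight y ≡ v → G x - dot d x ≡ G y - dot d y
  const = slice-constant (λ x → G x - dot d x) v λ {k} {x} {y} a p → begin
    G x - dot d x                                          ≡⟨ regroup (G x) (G y) (dot d x) (dot d y) ⟩
    (G x - G y) - (dot d x - dot d y) + (G y - dot d y)    ≡⟨ cong₂ (λ p q → p - q + (G y - dot d y)) (h a p) (dot-potential e a) ⟩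
    e k - e k + (G y - dot d y)                            ≡⟨ cong (_+ (G y - dot d y)) (ℤ.+-inverseʳ (e k)) ⟩
    0ℤ + (G y - dot d y)                                   ≡⟨ ℤ.+-identityˡ _ ⟩
    G y - dot d y                                          ∎
    where open ≡-Reasoning

diff : (Vec Bool (suc (suc n)) → ℤ) → Vec Bool n → ℤ
diff F y = F (t ∷ f ∷ y) - F (f ∷ t ∷ y)

-- Neighbours of `10y` and `01y` with prefix 11 or 00 are common to both and cancel, as does `c`.
-- The two vectors are also adjacent to each other, which accounts for the `+ 1`.
diff-eigen : ∀ v (lam c : ℤ) (F : Vec Bool (suc (suc n)) → ℤ) →
  (∀ x → weight x ≡ suc v → nb F x ≡ lam * F x + c) →
  ∀ y → weight y ≡ v → nb (diff F) y ≡ (lam + 1ℤ) * diff F y + 0ℤ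
diff-eigen v lam c F h y p = begin
  nb (diff F) y                            ≡⟨ nb-sub (λ y → F (t ∷ f ∷ y)) (λ y → F (f ∷ t ∷ y)) y ⟩
  nb (λ y → F (t ∷ f ∷ y)) y - nb (λ y → F (f ∷ t ∷ y)) y
    ≡⟨ regroup (nb (λ y → F (t ∷ f ∷ y)) y) (nb (λ y → F (f ∷ t ∷ y)) y) (dn (λ y → F (t ∷ t ∷ y)) y) (up (λ y → F (f ∷ f ∷ y)) y) (F (t ∷ f ∷ y)) (F (f ∷ t ∷ y)) ⟩
  nb F (t ∷ f ∷ y) - nb F (f ∷ t ∷ y) + diff F y
    ≡⟨ cong₂ (λ a b → a - b + diff F y) (h (t ∷ f ∷ y) (cong suc p)) (h (f ∷ t ∷ y) (cong suc p)) ⟩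
  (lam * F (t ∷ f ∷ y) + c) - (lam * F (f ∷ t ∷ y) + c) + diff F y
    ≡⟨ collect lam c (F (t ∷ f ∷ y)) (F (f ∷ t ∷ y)) ⟩
  (lam + 1ℤ) * diff F y + 0ℤ ∎
  where
  open ≡-Reasoning
  regroup : ∀ a b c d p q → a - b ≡ (a + c + (q + d)) - (b + d + (p + c)) + (p - q)
  regroup = solve-∀
  collect : ∀ l c p q → (l * p + c) - (l * q + c) + (p - q) ≡ (l + 1ℤ) * (p - q) + 0ℤ
  collect = solve-∀

-- The eigenvalues `w (n - w) - i (n + 1 - i)` of the Johnson graph for i = 0, 1, 2.
degree first-eigenvalue second-eigenvalue : ℕ → ℕ → ℤ
degree n w            = + w * (+ n - + w)
first-eigenvalue n w  = degree n w - + n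
second-eigenvalue n w = + w * (+ n - + w) - + 2 * + n + + 2

-- Making `F` a true eigenfunction would require adding a possibly fractional constant. The term
-- `shift` keeps `F` a bit and all values integral; it cancels in differences.
record Eigen (n w : ℕ) (F : Vec Bool n → ℤ) : Set where
  field
    boolean : ∀ x → F x ≡ 0ℤ ⊎ F x ≡ 1ℤ
    shift   : ℤ
    eigen   : ∀ x → weight x ≡ w → nb F x ≡ second-eigenvalue n w * F x + shift

open Eigen

permute : ∀ {n w F} → Eigen n w F → ∀ π → Eigen n w (F ∘ act π)
permute F-eig π .boolean x = F-eig .boolean (act π x)
permute F-eig π .shift     = F-eig .shift
permute {F = F} F-eig π .eigen x p = trans (nb-act F π x) (F-eig .eigen (act π x) (trans (weight-act π x) p))

-- The `+ 1` of `diff-eigen` lowers the index of the eigenvalue by one while passing to the graph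
-- with two coordinates and one one fewer.
second-eigenvalue-+1 : ∀ m v → second-eigenvalue (2 ℕ.+ m) (suc v) + 1ℤ ≡ first-eigenvalue m v
-- The casts are replaced by variables with definitional equations, which leaves a polynomial
-- identity for the ring solver.
second-eigenvalue-+1 m v = shifted (+ m) (+ v) (+ (2 ℕ.+ m)) (+ suc v) refl refl
  where
  shifted : ∀ m v n w → n ≡ + 2 + m → w ≡ 1ℤ + v → w * (n - w) - + 2 * n + + 2 + 1ℤ ≡ v * (m - v) - m
  shifted m v _ _ refl refl = expand m v
    where
    expand : ∀ m v → (1ℤ + v) * ((+ 2 + m) - (1ℤ + v)) - + 2 * (+ 2 + m) + + 2 + 1ℤ ≡ v * (m - v) - m
    expand = solve-∀

first-eigenvalue-+1 : ∀ m v → first-eigenvalue (2 ℕ.+ m) (suc v) + 1ℤ ≡ degree m v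
first-eigenvalue-+1 m v = shifted (+ m) (+ v) (+ (2 ℕ.+ m)) (+ suc v) refl refl
  where
  shifted : ∀ m v n w → n ≡ + 2 + m → w ≡ 1ℤ + v → w * (n - w) - n + 1ℤ ≡ v * (m - v)
  shifted m v _ _ refl refl = expand m v
    where
    expand : ∀ m v → (1ℤ + v) * ((+ 2 + m) - (1ℤ + v)) - (+ 2 + m) + 1ℤ ≡ v * (m - v)
    expand = solve-∀

diff-eigen₂ : ∀ {m v F} → Eigen (2 ℕ.+ m) (suc v) F →
  ∀ y → weight y ≡ v → nb (diff F) y ≡ first-eigenvalue m v * diff F y + 0ℤ
diff-eigen₂ {m} {v} {F} F-eig y p = trans (diff-eigen v (second-eigenvalue (2 ℕ.+ m) (suc v)) (F-eig .shift) F (F-eig .eigen) y p)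
  (cong (λ l → l * diff F y + 0ℤ) (second-eigenvalue-+1 m v))

-- Two exchanges turn the second eigenvalue into the degree, where the maximum principle applies. Of
-- the `5 + m` coordinates at least one remains, as `harmonic-constant` requires.
diff-diff-constant : ∀ {m v F} → Eigen (5 ℕ.+ m) (suc (suc v)) F →
  ∀ x y → weight x ≡ v → weight y ≡ v → diff (diff F) x ≡ diff (diff F) y
diff-diff-constant {m} {v} {F} F-eig = harmonic-constant v (diff (diff F)) λ x p →
  trans (diff-eigen v (first-eigenvalue (3 ℕ.+ m) (suc v)) 0ℤ (diff F) (diff-eigen₂ F-eig) x p)
    (trans (ℤ.+-identityʳ ((first-eigenvalue (3 ℕ.+ m) (suc v) + 1ℤ) * diff (diff F) x)) (cong (_* diff (diff F) x) (first-eigenvalue-+1 (suc m) v)))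

-- Compares the eigenvalue equation with `nb-affine` at a vertex. As the eigenvalue is the degree
-- minus `n`, the terms in `dot d y` cancel and a relation between `c` and `total d` remains.
affine-coefficients : ∀ v (G : Vec Bool n → ℤ) c d →
  (∀ y → weight y ≡ v → nb G y ≡ first-eigenvalue n v * G y + 0ℤ) →
  (∀ y → weight y ≡ v → G y ≡ c + dot d y) →
  ∀ (y : Vec Bool n) → weight y ≡ v → + n * c ≡ - (+ v * total d)
affine-coefficients {n} v G c d eig aff y refl =
  finish (degree n v) (+ n) c (dot d y) (+ v * total d) (trans (sym lhs) rhs)
  where
  finish : ∀ e n c s T → (e - n) * (c + s) ≡ e * (c + s) + (T - n * s) → n * c ≡ - T
  finish e n c s T eq = begin
    n * c                                                      ≡⟨ isolate e n c s T ⟩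
    e * (c + s) + (T - n * s) - (e - n) * (c + s) - T          ≡⟨ cong (λ a → e * (c + s) + (T - n * s) - a - T) eq ⟩
    e * (c + s) + (T - n * s) - (e * (c + s) + (T - n * s)) - T ≡⟨ cancel (e * (c + s) + (T - n * s)) T ⟩
    - T                                                        ∎
    where
    open ≡-Reasoning
    isolate : ∀ e n c s T → n * c ≡ e * (c + s) + (T - n * s) - (e - n) * (c + s) - T
    isolate = solve-∀
    cancel : ∀ a T → a - a - T ≡ - T
    cancel = solve-∀
  lhs : nb G y ≡ first-eigenvalue n v * (c + dot d y)
  lhs = trans (eig y refl) (trans (ℤ.+-identityʳ (first-eigenvalue n v * G y))
    (cong (first-eigenvalue n v *_) (aff y refl)))
  rhs : nb G y ≡ degree n v * (c + dot d y) + (+ v * total d - + n * dot d y)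
  rhs = trans (nb-cong y aff) (nb-affine c d y)

diff-affine : ∀ {m v F} → Eigen (5 ℕ.+ m) (suc (suc v)) F → v ≤ suc m →
  ∃[ c ] ∃[ d ] (∀ y → weight y ≡ suc v → diff F y ≡ c + dot d y) × + (3 ℕ.+ m) * c ≡ - (+ suc v * total d)
diff-affine {m} {v} {F} F-eig v≤ =
  c , d , aff , affine-coefficients (suc v) (diff F) c d (diff-eigen₂ F-eig) aff (t ∷ f ∷ z₀) (cong suc p₀)
  where
  z₀ = proj₁ (vertex v≤)
  p₀ = proj₂ (vertex v≤)
  -- The change of `diff F` along a move at `k` is a second difference of a permuted `F`. It is
  -- constant on its slice, so it may be read off at `z₀`.
  slope : Fin (suc (suc m)) → ℤ
  slope k = diff (diff (F ∘ act (lift (lift (toPos k))))) z₀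
  swap-diff : ∀ {k x y} → Adj k x y → weight x ≡ suc v → diff F x - diff F y ≡ slope k
  swap-diff {k} a p with z , refl , refl ← adj-split a =
    diff-diff-constant (permute F-eig (lift (lift (toPos k)))) z z₀
      (ℕ.suc-injective (trans (sym (weight-act (toPos k) (t ∷ f ∷ z))) p)) p₀
  sol = affine (suc v) (diff F) slope swap-diff (ℕ.m≤n⇒m≤1+n (s≤s v≤))
  c = proj₁ sol
  d = proj₁ (proj₂ sol)
  aff = proj₂ (proj₂ sol)

-- Bounded affine functions on a slice

-- The order is a parameter so that the same selection yields a maximum and, with the reversed
-- order, a minimum.
front-greatest : ∀ (_≼_ : ℤ → ℤ → Set) → (∀ a b → a ≼ b ⊎ b ≼ a) → (∀ {a b c} → a ≼ b → b ≼ c → a ≼ c) →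
  ∀ (d : Vec ℤ (suc n)) → ∃[ π ] ∃[ a ] ∃[ r ] act π d ≡ a ∷ r × All (_≼ a) r
front-greatest _≼_ tot tr (a ∷ []) = idp , a , [] , refl , []
front-greatest _≼_ tot tr (a ∷ b ∷ d) with front-greatest _≼_ tot tr (b ∷ d)
... | π , m , r , eq , all with tot m a
...   | inj₁ m≼a = lift π , a , m ∷ r , cong (a ∷_) eq , m≼a ∷ All.map (λ x≼m → tr x≼m m≼a) all
...   | inj₂ a≼m = swp ⊙ lift π , m , a ∷ r , cong (λ s → act swp (a ∷ s)) eq , a≼m ∷ all

front-extremes : ∀ (d : Vec ℤ (suc (suc n))) → ∃[ π ] ∃[ a ] ∃[ b ] ∃[ r ]
  act π d ≡ a ∷ b ∷ r × b ≤ᶻ a × All (λ x → b ≤ᶻ x × x ≤ᶻ a) r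
front-extremes d with front-greatest _≤ᶻ_ ℤ.≤-total ℤ.≤-trans d
... | π , a , s , eq , s≤a with front-greatest (λ x y → y ≤ᶻ x) (λ x y → ℤ.≤-total y x) (λ p q → ℤ.≤-trans q p) s
...   | ρ , b , r , eq' , b≤r with subst (All (_≤ᶻ a)) eq' (all-act ρ s≤a)
...     | b≤a ∷ r≤a = lift ρ ⊙ π , a , b , r , trans (cong (act (lift ρ)) eq) (cong (a ∷_) eq') , b≤a , All.zip (b≤r , r≤a)

gap : ∀ {a b} → a ≤ᶻ b → ∃[ i ] b ≡ a + + i
gap {a} {b} a≤b = ∣ b - a ∣ , trans (split a b) (cong (λ s → a + s) (sym (ℤ.0≤i⇒+∣i∣≡i (ℤ.i≤j⇒0≤j-i a≤b))))
  where
  split : ∀ a b → b ≡ a + (b - a)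
  split = solve-∀

replicate-all : ∀ {r} {d : Vec ℤ n} → All (λ x → r ≤ᶻ x × x ≤ᶻ r) d → d ≡ replicate n r
replicate-all []              = refl
replicate-all ((p , q) ∷ all) = cong₂ _∷_ (ℤ.≤-antisym q p) (replicate-all all)

-- On a slice the coefficients of an affine function matter only up to a common summand, which can
-- be traded against the constant.
dot-shift : ∀ r (d : Vec ℤ n) y → dot (map (_- r) d) y ≡ dot d y - r * + weight y
dot-shift r []      []      = sym (cong (λ s → 0ℤ - s) (ℤ.*-zeroʳ r))
dot-shift r (a ∷ d) (t ∷ y) = trans (cong (λ s → (a - r) * 1ℤ + s) (dot-shift r d y)) (expand a r (dot d y) (+ weight y))
  where
  expand : ∀ a r s w → (a - r) * 1ℤ + (s - r * w) ≡ a * 1ℤ + s - r * (1ℤ + w)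
  expand = solve-∀
dot-shift r (a ∷ d) (f ∷ y) = trans (cong (λ s → (a - r) * 0ℤ + s) (dot-shift r d y)) (expand a r (dot d y) (+ weight y))
  where
  expand : ∀ a r s w → (a - r) * 0ℤ + (s - r * w) ≡ a * 0ℤ + s - r * w
  expand = solve-∀

act-map : ∀ (g : ℤ → ℤ) (π : Perm n) d → act π (map g d) ≡ map g (act π d)
act-map g idp      d           = refl
act-map g swp      (a ∷ b ∷ d) = refl
act-map g (lift π) (a ∷ d)     = cong (g a ∷_) (act-map g π d)
act-map g (π ⊙ ρ)  d           = trans (cong (act π) (act-map g ρ d)) (act-map g π _)

dot-inv : ∀ (π : Perm n) d y → dot d (act (inv π) y) ≡ dot (act π d) y
dot-inv π d y = trans (sym (dot-act π d (act (inv π) y))) (cong (dot (act π d)) (act-inv π y))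

-- The right-hand side has absolute value at most `2 W < N`, and a nonzero `X` would make the
-- left-hand side at least `N`.
balanced : ∀ {N W} X A B → 0 < W → W ℕ.* 2 < N → B ℕ.+ A ≤ 2 →
  + N * X ≡ + W * (+ B - + A) → B ≡ A × X ≡ 0ℤ
balanced {N} {W} X A B 0<W 2W<N le eq = B≡A (∣X∣≡0 ∣ X ∣ refl) , ℤ.∣i∣≡0⇒i≡0 (∣X∣≡0 ∣ X ∣ refl)
  where
  abs-eq : N ℕ.* ∣ X ∣ ≡ W ℕ.* ∣ + B - + A ∣
  abs-eq = trans (sym (ℤ.abs-* (+ N) X)) (trans (cong ∣_∣ eq) (ℤ.abs-* (+ W) (+ B - + A)))
  bound : N ℕ.* ∣ X ∣ < N
  bound = subst (_< N) (sym abs-eq) (ℕ.≤-<-trans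
    (ℕ.*-monoʳ-≤ W (ℕ.≤-trans (ℤ.∣i-j∣≤∣i∣+∣j∣ (+ B) (+ A)) le)) 2W<N)
  ∣X∣≡0 : ∀ j → ∣ X ∣ ≡ j → j ≡ 0
  ∣X∣≡0 zero    _ = refl
  ∣X∣≡0 (suc j) e = ⊥-elim (ℕ.<-irrefl refl (ℕ.≤-<-trans (subst (λ j → N ≤ N ℕ.* j) (sym e) (ℕ.m≤m*n N (suc j))) bound))
  B≡A : ∣ X ∣ ≡ 0 → B ≡ A
  B≡A e with ℕ.m*n≡0⇒m≡0∨n≡0 W (trans (sym abs-eq) (trans (cong (N ℕ.*_) e) (ℕ.*-zeroʳ N)))
  ... | inj₁ W≡0 = ⊥-elim (ℕ.<-irrefl (sym W≡0) 0<W)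
  ... | inj₂ z   = ℤ.+-injective (ℤ.i-j≡0⇒i≡j (+ B) (+ A) (ℤ.∣i∣≡0⇒i≡0 z))

-- Gaps between consecutive extremes: i and i′ enter both (a₁ − b₁) and (a₂ − b₂), hence count twice in the spread.
record Deviation (a₁ b₁ a₂ b₂ a₃ b₃ : ℤ) : Set where
  field
    i i′ j j′ : ℕ
    b₃≡ : b₃ ≡ a₃
    a₂≡ : a₂ ≡ a₃ + + i
    a₁≡ : a₁ ≡ a₃ + + i + + j
    b₂≡ : b₂ ≡ a₃ - + i′
    b₁≡ : b₁ ≡ a₃ - + i′ - + j′
    small : (j′ ℕ.+ 2 ℕ.* i′) ℕ.+ (j ℕ.+ 2 ℕ.* i) ≤ 2

-- The innermost gap `k = a₃ - b₃` lies inside all three differences and so counts three times in a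
-- sum bounded by 2. Hence it is zero.
deviation : ∀ {a₁ b₁ a₂ b₂ a₃ b₃} → a₂ ≤ᶻ a₁ → a₃ ≤ᶻ a₂ → b₃ ≤ᶻ a₃ → b₂ ≤ᶻ b₃ → b₁ ≤ᶻ b₂ →
  (a₁ - b₁) + ((a₂ - b₂) + (a₃ - b₃)) ≤ᶻ + 2 → Deviation a₁ b₁ a₂ b₂ a₃ b₃
deviation {b₁ = b} p q r s u le with gap u
... | j′ , refl with gap s
... | i′ , refl with gap r
... | k , refl with gap q
... | i , refl with gap p
... | j , refl = go k (drop (subst (_≤ᶻ + 2) (expand b (+ j′) (+ i′) (+ k) (+ i) (+ j)) le))
  where
  expand : ∀ b j′ i′ k i j →
    (b + j′ + i′ + k + i + j - b) + ((b + j′ + i′ + k + i - (b + j′)) + (b + j′ + i′ + k - (b + j′ + i′)))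
    ≡ j′ + (i′ + (i′ + 0ℤ)) + (j + (i + (i + 0ℤ))) + (k + (k + (k + 0ℤ)))
  expand = solve-∀
  drop : ∀ {m} → + m ≤ᶻ + 2 → m ≤ 2
  drop (+≤+ h) = h
  go : ∀ k → (j′ ℕ.+ 2 ℕ.* i′) ℕ.+ (j ℕ.+ 2 ℕ.* i) ℕ.+ 3 ℕ.* k ≤ 2 →
    Deviation (b + + j′ + + i′ + + k + + i + + j) b (b + + j′ + + i′ + + k + + i) (b + + j′) (b + + j′ + + i′ + + k) (b + + j′ + + i′)
  go zero    h = record
    { i = i ; i′ = i′ ; j = j ; j′ = j′
    ; b₃≡ = sym (ℤ.+-identityʳ _)
    ; a₂≡ = refl ; a₁≡ = refl
    ; b₂≡ = back₂ b (+ j′) (+ i′) ; b₁≡ = back₁ b (+ j′) (+ i′)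
    ; small = subst (_≤ 2) (ℕ.+-identityʳ _) h }
    where
    back₂ : ∀ b j i → b + j ≡ b + j + i + 0ℤ - i
    back₂ = solve-∀
    back₁ : ∀ b j i → b ≡ b + j + i + 0ℤ - i - j
    back₁ = solve-∀
  go (suc k) h = ⊥-elim (ℕ.<-irrefl refl (ℕ.≤-trans (ℕ.≤-trans (ℕ.m≤m*n 3 (suc k)) (ℕ.m≤n+m _ _)) h))

front-six : ∀ (d : Vec ℤ (6 ℕ.+ n)) → ∃[ π ] ∃[ a₁ ] ∃[ b₁ ] ∃[ a₂ ] ∃[ b₂ ] ∃[ a₃ ] ∃[ b₃ ] ∃[ r ]
  act π d ≡ a₁ ∷ b₁ ∷ a₂ ∷ b₂ ∷ a₃ ∷ b₃ ∷ r ×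
  a₂ ≤ᶻ a₁ × a₃ ≤ᶻ a₂ × b₃ ≤ᶻ a₃ × b₂ ≤ᶻ b₃ × b₁ ≤ᶻ b₂ × All (λ x → b₃ ≤ᶻ x × x ≤ᶻ a₃) r
front-six d with front-extremes d
... | π , a₁ , b₁ , r₁ , eq₁ , _ , all₁ with front-extremes r₁
... | ρ , a₂ , b₂ , r₂ , eq₂ , _ , all₂ with subst (All _) eq₂ (all-act ρ all₁)
... | (_ , a₂≤a₁) ∷ (b₁≤b₂ , _) ∷ _ with front-extremes r₂
... | σ , a₃ , b₃ , r₃ , eq₃ , b₃≤a₃ , all₃ with subst (All _) eq₃ (all-act σ all₂)
... | (_ , a₃≤a₂) ∷ (b₂≤b₃ , _) ∷ _ =
  lift (lift (lift (lift σ))) ⊙ lift (lift ρ) ⊙ π , a₁ , b₁ , a₂ , b₂ , a₃ , b₃ , r₃ ,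
  trans (cong (act (lift (lift (lift (lift σ)))) ∘ act (lift (lift ρ))) eq₁)
    (trans (cong (act (lift (lift (lift (lift σ)))) ∘ (λ s → a₁ ∷ b₁ ∷ s)) eq₂)
      (cong (λ s → a₁ ∷ b₁ ∷ a₂ ∷ b₂ ∷ s) eq₃)) ,
  a₂≤a₁ , a₃≤a₂ , b₃≤a₃ , b₂≤b₃ , b₁≤b₂ , all₃

-- The shift s is the common value of all but at most four coefficients.
normal-form : ∀ {k v} → 2 ℕ.* v < k → ∀ c (e : Vec ℤ (6 ℕ.+ k)) {a₁ b₁ a₂ b₂ a₃ b₃ r} →
  e ≡ a₁ ∷ b₁ ∷ a₂ ∷ b₂ ∷ a₃ ∷ b₃ ∷ r → Deviation a₁ b₁ a₂ b₂ a₃ b₃ →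
  All (λ x → b₃ ≤ᶻ x × x ≤ᶻ a₃) r →
  + (6 ℕ.+ k) * c ≡ - (+ (3 ℕ.+ v) * total e) →
  ∃[ s ] c + s * + (3 ℕ.+ v) ≡ 0ℤ ×
    (map (_- s) e ≡ replicate _ 0ℤ ⊎ map (_- s) e ≡ 1ℤ ∷ -1ℤ ∷ replicate _ 0ℤ)
normal-form {k} {v} 2v<k c e {a₃ = s} {r = r} refl
  record { i = i ; i′ = i′ ; j = j ; j′ = j′ ; b₃≡ = refl ; a₂≡ = refl ; a₁≡ = refl ; b₂≡ = refl ; b₁≡ = refl ; small = small } all eq
  with refl ← replicate-all all = s , proj₂ bal , shape i i′ j j′ (proj₁ bal) small
  where
  -- `A` is the total excess of the coefficients above `s`, and `B` the total deficit below it.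
  A = j ℕ.+ 2 ℕ.* i
  B = j′ ℕ.+ 2 ℕ.* i′
  N = 6 ℕ.+ k
  W = 3 ℕ.+ v

  total-e : total e ≡ + N * s + (+ A - + B)
  total-e = trans (cong (λ T → s + + i + + j + (s - + i′ - + j′ + (s + + i + (s - + i′ + (s + (s + T)))))) (total-replicate k s))
    (expand s (+ i) (+ i′) (+ j) (+ j′) (+ k))
    where
    expand : ∀ s i i′ j j′ k → s + i + j + (s - i′ - j′ + (s + i + (s - i′ + (s + (s + k * s)))))
      ≡ (+ 6 + k) * s + (j + (i + (i + 0ℤ)) - (j′ + (i′ + (i′ + 0ℤ))))
    expand = solve-∀

  bal : B ≡ A × c + s * + W ≡ 0ℤ
  bal = balanced {N} {W} (c + s * + W) A B (s≤s z≤n) 2W<N small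
    (finish (+ N) (+ W) c s (+ A) (+ B) (trans eq (cong (λ T → - (+ W * T)) total-e)))
    where
    2W<N : W ℕ.* 2 < N
    2W<N = subst (_< N) (ℕ.*-comm 2 W) (subst (_< N) (sym (ℕ.*-distribˡ-+ 2 3 v)) (ℕ.+-monoʳ-< 6 2v<k))
    finish : ∀ N W c s A B → N * c ≡ - (W * (N * s + (A - B))) → N * (c + s * W) ≡ W * (B - A)
    finish N W c s A B eq = trans (distr N W c s) (trans (cong (_+ N * (s * W)) eq) (collect N W s A B))
      where
      distr : ∀ N W c s → N * (c + s * W) ≡ N * c + N * (s * W)
      distr = solve-∀
      collect : ∀ N W s A B → - (W * (N * s + (A - B))) + N * (s * W) ≡ W * (B - A)
      collect = solve-∀

  half : ∀ {m} → m ℕ.+ m ≤ 2 → m ≤ 1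
  half {0}           _ = z≤n
  half {1}           _ = s≤s z≤n
  half {suc (suc m)} (s≤s (s≤s h)) with () ← subst (_≤ 0) (ℕ.+-suc m (suc m)) h

  units : ∀ j i → j ℕ.+ 2 ℕ.* i ≤ 1 → i ≡ 0 × (j ≡ 0 ⊎ j ≡ 1)
  units 0 zero    _ = refl , inj₁ refl
  units 1 zero    _ = refl , inj₂ refl
  units (suc (suc j)) i (s≤s ())
  units j (suc i) h with s≤s () ← ℕ.≤-trans (ℕ.≤-trans (ℕ.m≤m*n 2 (suc i)) (ℕ.m≤n+m _ j)) h

  plus : ∀ s j → s + 0ℤ + j - s ≡ j
  plus = solve-∀
  minus : ∀ s j → s - 0ℤ - j - s ≡ - j
  minus = solve-∀

  rest : map (_- s) (s + 0ℤ ∷ s - 0ℤ ∷ s ∷ s ∷ replicate k s) ≡ replicate _ 0ℤ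
  rest = trans (cong₂ (λ x y → map (_- s) (x ∷ y ∷ s ∷ s ∷ replicate k s)) (ℤ.+-identityʳ s) (ℤ.+-identityʳ s))
    (trans (map-replicate (_- s) s (4 ℕ.+ k)) (cong (replicate _) (ℤ.+-inverseʳ s)))

  -- Excess and deficit are equal with sum at most 2, so each is at most 1. The gaps counted twice
  -- vanish, and `j = j′` is 0 or 1.
  shape : ∀ i i′ j j′ → j′ ℕ.+ 2 ℕ.* i′ ≡ j ℕ.+ 2 ℕ.* i →
    (j′ ℕ.+ 2 ℕ.* i′) ℕ.+ (j ℕ.+ 2 ℕ.* i) ≤ 2 →
    let e = s + + i + + j ∷ s - + i′ - + j′ ∷ s + + i ∷ s - + i′ ∷ s ∷ s ∷ replicate k s in
    map (_- s) e ≡ replicate _ 0ℤ ⊎ map (_- s) e ≡ 1ℤ ∷ -1ℤ ∷ replicate _ 0ℤ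
  shape i i′ j j′ B≡A le with units j i (half (subst (λ B → B ℕ.+ (j ℕ.+ 2 ℕ.* i) ≤ 2) B≡A le))
                            | units j′ i′ (half (subst (λ A → j′ ℕ.+ 2 ℕ.* i′ ℕ.+ A ≤ 2) (sym B≡A) le))
  ... | refl , inj₁ refl | refl , inj₁ refl = inj₁ (cong₂ _∷_ (plus s 0ℤ) (cong₂ _∷_ (minus s 0ℤ) rest))
  ... | refl , inj₂ refl | refl , inj₂ refl = inj₂ (cong₂ _∷_ (plus s 1ℤ) (cong₂ _∷_ (minus s 1ℤ) rest))
  ... | refl , inj₁ refl | refl , inj₂ refl with () ← B≡A
  ... | refl , inj₂ refl | refl , inj₁ refl with () ← B≡A

-- G is, on the vectors of weight w, either zero or the difference of two coordinates.
Sparse : ℕ → (Vec Bool (suc (suc n)) → ℤ) → Set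
Sparse w G = ∃[ d ] (∀ y → weight y ≡ w → G y ≡ dot d y) ×
  ((∀ y → dot d y ≡ 0ℤ) ⊎ ∃[ π ] act π d ≡ 1ℤ ∷ -1ℤ ∷ replicate _ 0ℤ)

sparse-cong : ∀ {w} {G H : Vec Bool (suc (suc n)) → ℤ} →
  (∀ y → weight y ≡ w → G y ≡ H y) → Sparse w H → Sparse w G
sparse-cong G≡H (d , H≡ , shape) = d , (λ y p → trans (G≡H y p) (H≡ y p)) , shape

two-coefficients : ∀ {k v} → 2 ℕ.* v < k → ∀ c (d : Vec ℤ (6 ℕ.+ k)) →
  (∀ y → weight y ≡ 3 ℕ.+ v → -1ℤ ≤ᶻ c + dot d y × c + dot d y ≤ᶻ 1ℤ) →
  + (6 ℕ.+ k) * c ≡ - (+ (3 ℕ.+ v) * total d) →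
  Sparse (3 ℕ.+ v) (λ y → c + dot d y)
two-coefficients {k} {v} 2v<k c d bounded balance with front-six d
... | π , a₁ , b₁ , a₂ , b₂ , a₃ , b₃ , r , eq , a₂≤a₁ , a₃≤a₂ , b₃≤a₃ , b₂≤b₃ , b₁≤b₂ , all =
  let s , c≡ , sh = normal-form 2v<k c (act π d) eq (deviation a₂≤a₁ a₃≤a₂ b₃≤a₃ b₂≤b₃ b₁≤b₂ spread) all
                      (trans balance (cong (λ T → - (+ W * T)) (sym (total-act π d))))
  in map (_- s) d , (λ y p → shifted s c≡ y p) , conclude s sh
  where
  W = 3 ℕ.+ v

  bounded′ : ∀ y → weight y ≡ W → -1ℤ ≤ᶻ c + dot (act π d) y × c + dot (act π d) y ≤ᶻ 1ℤ
  bounded′ y p = subst (λ s → -1ℤ ≤ᶻ c + s × c + s ≤ᶻ 1ℤ) (dot-inv π d y)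
    (bounded (act (inv π) y) (trans (weight-act (inv π) y) p))

  -- `y₁` picks the three greatest coefficients and `y₂` the three least, with a common tail of
  -- weight `v`. Both values lie between -1 and 1.
  spread : (a₁ - b₁) + ((a₂ - b₂) + (a₃ - b₃)) ≤ᶻ + 2
  spread with z , p ← vertex {k} {v} (ℕ.≤-trans (ℕ.m≤n*m v 2) (ℕ.<⇒≤ 2v<k)) =
    subst (_≤ᶻ + 2) (trans (cong (λ e → (c + dot e y₁) - (c + dot e y₂)) eq) (cancel c a₁ b₁ a₂ b₂ a₃ b₃ (dot r z)))
      (ℤ.+-mono-≤ (proj₂ (bounded′ y₁ q)) (ℤ.neg-mono-≤ (proj₁ (bounded′ y₂ q))))
    where
    y₁ y₂ : Vec Bool (6 ℕ.+ k)
    y₁ = t ∷ f ∷ t ∷ f ∷ t ∷ f ∷ z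
    y₂ = f ∷ t ∷ f ∷ t ∷ f ∷ t ∷ z
    q : 3 ℕ.+ weight z ≡ W
    q = cong (3 ℕ.+_) p
    cancel : ∀ c a₁ b₁ a₂ b₂ a₃ b₃ s →
      (c + (a₁ * 1ℤ + (b₁ * 0ℤ + (a₂ * 1ℤ + (b₂ * 0ℤ + (a₃ * 1ℤ + (b₃ * 0ℤ + s)))))))
      - (c + (a₁ * 0ℤ + (b₁ * 1ℤ + (a₂ * 0ℤ + (b₂ * 1ℤ + (a₃ * 0ℤ + (b₃ * 1ℤ + s)))))))
      ≡ (a₁ - b₁) + ((a₂ - b₂) + (a₃ - b₃))
    cancel = solve-∀

  -- Subtracting `s` from every coefficient frees `s W` on this slice, which cancels the constant
  -- `c`.
  shifted : ∀ s → c + s * + W ≡ 0ℤ → ∀ y → weight y ≡ W → c + dot d y ≡ dot (map (_- s) d) y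
  shifted s c≡ y p = begin
    c + dot d y                              ≡⟨ regroup c (dot d y) (s * + W) ⟩
    c + s * + W + (dot d y - s * + W)        ≡⟨ cong (_+ (dot d y - s * + W)) c≡ ⟩
    0ℤ + (dot d y - s * + W)                 ≡⟨ ℤ.+-identityˡ _ ⟩
    dot d y - s * + W                        ≡⟨ cong (λ w → dot d y - s * + w) p ⟨
    dot d y - s * + weight y                 ≡⟨ dot-shift s d y ⟨
    dot (map (_- s) d) y                     ∎
    where
    open ≡-Reasoning
    regroup : ∀ c x u → c + x ≡ c + u + (x - u)
    regroup = solve-∀

  conclude : ∀ s → map (_- s) (act π d) ≡ replicate _ 0ℤ ⊎ map (_- s) (act π d) ≡ 1ℤ ∷ -1ℤ ∷ replicate _ 0ℤ →
    (∀ y → dot (map (_- s) d) y ≡ 0ℤ) ⊎ ∃[ ρ ] act ρ (map (_- s) d) ≡ 1ℤ ∷ -1ℤ ∷ replicate _ 0ℤ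
  conclude s (inj₁ e) = inj₁ λ y → trans (sym (dot-act π (map (_- s) d) y))
    (trans (cong (λ e → dot e (act π y)) (trans (act-map (_- s) π d) e)) (dot-replicate-0 (act π y)))
  conclude s (inj₂ e) = inj₂ (π , trans (act-map (_- s) π d) e)

-- Exclusion of non-zero differences

square-nonneg : ∀ a → 0ℤ ≤ᶻ a * a
square-nonneg (+ zero)   = +≤+ z≤n
square-nonneg (+ suc n)  = +≤+ z≤n
square-nonneg (-[1+ n ]) = +≤+ z≤n

≤-square-+ : ∀ a {x S} → x ≤ᶻ S → x ≤ᶻ a * a + S
≤-square-+ a {x} x≤S = subst (_≤ᶻ _) (ℤ.+-identityˡ x) (ℤ.+-mono-≤ (square-nonneg a) x≤S)

sumsq-nonneg : ∀ (d : Vec ℤ n) → 0ℤ ≤ᶻ sumsq d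
sumsq-nonneg []      = ℤ.≤-refl
sumsq-nonneg (a ∷ d) = sum-nonneg (square-nonneg a) (sumsq-nonneg d)

three-squares : ∀ a {S} → 0ℤ ≤ᶻ S → a * a + (a * a + (a * a + S)) ≤ᶻ + 2 → a ≡ 0ℤ
three-squares a p le = go a p le
  where
  too-big : ∀ x s → ¬ (suc x ℕ.+ (suc x ℕ.+ (suc x ℕ.+ s)) ≤ 2)
  too-big x s (s≤s h) with ℕ.≤-trans (ℕ.m≤n+m (suc x ℕ.+ (suc x ℕ.+ s)) x) h
  ... | s≤s h′ with () ← ℕ.≤-trans (ℕ.m≤n+m (suc x ℕ.+ s) x) h′
  go : ∀ a {S} → 0ℤ ≤ᶻ S → a * a + (a * a + (a * a + S)) ≤ᶻ + 2 → a ≡ 0ℤ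
  go (+ zero)   _                 _        = refl
  -- The first argument of `too-big` is the predecessor of the square of `suc m`.
  go (+ suc m)  {+ s} (+≤+ _) (+≤+ h) = ⊥-elim (too-big (m ℕ.+ m ℕ.* suc m) s h)
  go (-[1+ m ]) {+ s} (+≤+ _) (+≤+ h) = ⊥-elim (too-big (m ℕ.+ m ℕ.* suc m) s h)

sumsq-zeros : ∀ n → sumsq (replicate n 0ℤ) ≡ 0ℤ
sumsq-zeros zero    = refl
sumsq-zeros (suc n) = trans (ℤ.+-identityˡ _) (sumsq-zeros n)

-- Total and sum of squares are invariant under permutation. The exclusion arguments use these two
-- numbers and so need not locate the entries 1 and -1.
unit-pair-total : ∀ {n} (d : Vec ℤ (2 ℕ.+ n)) π → act π d ≡ 1ℤ ∷ -1ℤ ∷ replicate _ 0ℤ → total d ≡ 0ℤ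
unit-pair-total {n} d π e = trans (sym (total-act π d)) (trans (cong total e)
  (cong (λ s → 1ℤ + (-1ℤ + s)) (trans (total-replicate n 0ℤ) (ℤ.*-zeroʳ (+ n)))))

unit-pair-sumsq : ∀ {n} (d : Vec ℤ (2 ℕ.+ n)) π → act π d ≡ 1ℤ ∷ -1ℤ ∷ replicate _ 0ℤ → sumsq d ≡ + 2
unit-pair-sumsq {n} d π e = trans (sym (sumsq-act π d)) (trans (cong sumsq e) (cong (λ s → 1ℤ + (1ℤ + s)) (sumsq-zeros n)))

-- Exchanging a greatest with a least coefficient leaves the value unchanged, so all coefficients
-- are equal. At least three equal squares with sum at most 2 are zero.
dot-constant⇒zero : ∀ {n v} (d : Vec ℤ (3 ℕ.+ n)) → v ≤ suc n →
  (∀ x y → weight x ≡ suc v → weight y ≡ suc v → dot d x ≡ dot d y) → sumsq d ≤ᶻ + 2 →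
  (∀ y → dot d y ≡ 0ℤ) × total d ≡ 0ℤ × sumsq d ≡ 0ℤ
dot-constant⇒zero {n} {v} d v≤ const small with front-extremes d
... | π , a , b , r , eq , b≤a , all =
  (λ y → trans (sym (dot-act π d y)) (trans (cong (λ e → dot e (act π y)) zeros) (dot-replicate-0 (act π y)))) ,
  trans (sym (total-act π d)) (trans (cong total zeros) (trans (total-replicate (3 ℕ.+ n) 0ℤ) (ℤ.*-zeroʳ (+ (3 ℕ.+ n))))) ,
  trans (sym (sumsq-act π d)) (trans (cong sumsq zeros) (sumsq-zeros (3 ℕ.+ n)))
  where
  a≡b : a ≡ b
  a≡b with z , p ← vertex {suc n} v≤ = begin
    a                                                        ≡⟨ isolate a b (dot r z) ⟩
    dot (a ∷ b ∷ r) (t ∷ f ∷ z) - dot (a ∷ b ∷ r) (f ∷ t ∷ z) + b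
      ≡⟨ cong (λ e → dot e (t ∷ f ∷ z) - dot e (f ∷ t ∷ z) + b) eq ⟨
    dot (act π d) (t ∷ f ∷ z) - dot (act π d) (f ∷ t ∷ z) + b
      ≡⟨ cong₂ (λ x y → x - y + b) (dot-inv π d (t ∷ f ∷ z)) (dot-inv π d (f ∷ t ∷ z)) ⟨
    dot d (act (inv π) (t ∷ f ∷ z)) - dot d (act (inv π) (f ∷ t ∷ z)) + b
      ≡⟨ cong (λ x → x - dot d (act (inv π) (f ∷ t ∷ z)) + b)
           (const _ _ (trans (weight-act (inv π) (t ∷ f ∷ z)) (cong suc p)) (trans (weight-act (inv π) (f ∷ t ∷ z)) (cong suc p))) ⟩
    dot d (act (inv π) (f ∷ t ∷ z)) - dot d (act (inv π) (f ∷ t ∷ z)) + b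
      ≡⟨ cong (_+ b) (ℤ.+-inverseʳ (dot d (act (inv π) (f ∷ t ∷ z)))) ⟩
    0ℤ + b                                                   ≡⟨ ℤ.+-identityˡ b ⟩
    b                                                        ∎
    where
    open ≡-Reasoning
    isolate : ∀ a b s → a ≡ (a * 1ℤ + (b * 0ℤ + s)) - (a * 0ℤ + (b * 1ℤ + s)) + b
    isolate = solve-∀

  flat : act π d ≡ replicate (3 ℕ.+ n) a
  flat = trans eq (cong₂ (λ x s → a ∷ x ∷ s) (sym a≡b)
    (replicate-all (All.map (λ (p , q) → subst (_≤ᶻ _) (sym a≡b) p , q) all)))

  a≡0 : a ≡ 0ℤ
  a≡0 = three-squares a (sumsq-nonneg (replicate n a)) (subst (_≤ᶻ + 2) (trans (sym (sumsq-act π d)) (cong sumsq flat)) small)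

  zeros : act π d ≡ replicate (3 ℕ.+ n) 0ℤ
  zeros = trans flat (cong (replicate _) a≡0)

IsBit : ℤ → Set
IsBit a = a ≡ 0ℤ ⊎ a ≡ 1ℤ

bit-diff-bounds : ∀ {a b} → IsBit a → IsBit b → -1ℤ ≤ᶻ a - b × a - b ≤ᶻ 1ℤ
bit-diff-bounds (inj₁ refl) (inj₁ refl) = -≤+ , +≤+ z≤n
bit-diff-bounds (inj₁ refl) (inj₂ refl) = ℤ.≤-refl , -≤+
bit-diff-bounds (inj₂ refl) (inj₁ refl) = -≤+ , ℤ.≤-refl
bit-diff-bounds (inj₂ refl) (inj₂ refl) = -≤+ , +≤+ z≤n

bit-diff-1 : ∀ {a b} → IsBit a → IsBit b → a - b ≡ 1ℤ → a ≡ 1ℤ × b ≡ 0ℤ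
bit-diff-1 (inj₁ refl) (inj₁ refl) ()
bit-diff-1 (inj₁ refl) (inj₂ refl) ()
bit-diff-1 (inj₂ refl) (inj₁ refl) _ = refl , refl
bit-diff-1 (inj₂ refl) (inj₂ refl) ()

bit-diff--1 : ∀ {a b} → IsBit a → IsBit b → a - b ≡ -1ℤ → a ≡ 0ℤ × b ≡ 1ℤ
bit-diff--1 (inj₁ refl) (inj₁ refl) ()
bit-diff--1 (inj₁ refl) (inj₂ refl) _ = refl , refl
bit-diff--1 (inj₂ refl) (inj₁ refl) ()
bit-diff--1 (inj₂ refl) (inj₂ refl) ()

-- For a unit pair, comparing the three patterns gives `p = q`, `r = s` and a constant dot product
-- on the tail, whose coefficients then vanish. Total 0 gives `r = - p`, and the sum of squares
-- becomes `4 p² = 2`, impossible for an integer.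
sparse-zero : ∀ {n w} {G : Vec Bool (7 ℕ.+ n) → ℤ} → w ≤ suc n → Sparse (3 ℕ.+ w) G →
  (∀ z → weight z ≡ suc w → G (t ∷ f ∷ t ∷ f ∷ z) ≡ 0ℤ) →
  (∀ z → weight z ≡ suc w → G (f ∷ t ∷ t ∷ f ∷ z) ≡ 0ℤ) →
  (∀ z → weight z ≡ suc w → G (t ∷ f ∷ f ∷ t ∷ z) ≡ 0ℤ) →
  ∀ y → weight y ≡ 3 ℕ.+ w → G y ≡ 0ℤ
sparse-zero w≤ (d , G≡ , inj₁ vanish) h₁ h₂ h₃ y p = trans (G≡ y p) (vanish y)
sparse-zero {n} {w} {G} w≤ (p ∷ q ∷ r ∷ s ∷ d , G≡ , inj₂ (π , e)) h₁ h₂ h₃ _ _ = ⊥-elim contra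
  where
  eval : ∀ a b c e → (∀ z → weight z ≡ suc w → G (a ∷ b ∷ c ∷ e ∷ z) ≡ 0ℤ) →
    (∀ (z : Vec Bool (3 ℕ.+ n)) → weight (a ∷ b ∷ c ∷ e ∷ z) ≡ 2 ℕ.+ weight z) → ∀ z → weight z ≡ suc w →
    p * val a + (q * val b + (r * val c + (s * val e + dot d z))) ≡ 0ℤ
  eval a b c e h wt z eq = trans (sym (G≡ (a ∷ b ∷ c ∷ e ∷ z) (trans (wt z) (cong (2 ℕ.+_) eq)))) (h z eq)

  eq₁ = eval t f t f h₁ (λ _ → refl)
  eq₂ = eval f t t f h₂ (λ _ → refl)
  eq₃ = eval t f f t h₃ (λ _ → refl)

  z₀ : Vec Bool (3 ℕ.+ n)
  z₀ = proj₁ (vertex (s≤s (ℕ.m≤n⇒m≤1+n w≤)))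
  p₀ = proj₂ (vertex (s≤s (ℕ.m≤n⇒m≤1+n w≤)))

  solve-eq : ∀ x y u u′ → u ≡ 0ℤ → u′ ≡ 0ℤ → x - y ≡ u - u′ → x ≡ y
  solve-eq x y _ _ refl refl h = ℤ.i-j≡0⇒i≡j x y h

  p≡q : p ≡ q
  p≡q = solve-eq p q _ _ (eq₁ z₀ p₀) (eq₂ z₀ p₀) (ring p q r s (dot d z₀))
    where
    ring : ∀ p q r s S → p - q ≡ (p * 1ℤ + (q * 0ℤ + (r * 1ℤ + (s * 0ℤ + S)))) - (p * 0ℤ + (q * 1ℤ + (r * 1ℤ + (s * 0ℤ + S))))
    ring = solve-∀

  r≡s : r ≡ s
  r≡s = solve-eq r s _ _ (eq₁ z₀ p₀) (eq₃ z₀ p₀) (ring p q r s (dot d z₀))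
    where
    ring : ∀ p q r s S → r - s ≡ (p * 1ℤ + (q * 0ℤ + (r * 1ℤ + (s * 0ℤ + S)))) - (p * 1ℤ + (q * 0ℤ + (r * 0ℤ + (s * 1ℤ + S))))
    ring = solve-∀

  const : ∀ x y → weight x ≡ suc w → weight y ≡ suc w → dot d x ≡ dot d y
  const x y hx hy = solve-eq (dot d x) (dot d y) _ _ (eq₁ x hx) (eq₁ y hy) (ring p q r s (dot d x) (dot d y))
    where
    ring : ∀ p q r s S T → S - T ≡ (p * 1ℤ + (q * 0ℤ + (r * 1ℤ + (s * 0ℤ + S)))) - (p * 1ℤ + (q * 0ℤ + (r * 1ℤ + (s * 0ℤ + T))))
    ring = solve-∀

  all-squares : p * p + (q * q + (r * r + (s * s + sumsq d))) ≡ + 2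
  all-squares = unit-pair-sumsq (p ∷ q ∷ r ∷ s ∷ d) π e

  rest : (∀ y → dot d y ≡ 0ℤ) × total d ≡ 0ℤ × sumsq d ≡ 0ℤ
  rest = dot-constant⇒zero d w≤ const (subst (sumsq d ≤ᶻ_) all-squares
    (≤-square-+ p (≤-square-+ q (≤-square-+ r (≤-square-+ s ℤ.≤-refl)))))

  contra : ⊥
  contra = go p q r s p≡q r≡s (proj₁ (proj₂ rest)) (proj₂ (proj₂ rest))
    (unit-pair-total (p ∷ q ∷ r ∷ s ∷ d) π e) all-squares
    where
    go : ∀ p q r s {T S} → p ≡ q → r ≡ s → T ≡ 0ℤ → S ≡ 0ℤ →
      p + (q + (r + (s + T))) ≡ 0ℤ → p * p + (q * q + (r * r + (s * s + S))) ≡ + 2 → ⊥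
    go p _ r _ refl refl refl refl tot sq = absurd p≡0
      where
      r≡-p : r ≡ - p
      r≡-p with ℤ.i*j≡0⇒i≡0∨j≡0 (+ 2) (trans (double p r) tot)
        where
        double : ∀ p r → + 2 * (p + r) ≡ p + (p + (r + (r + 0ℤ)))
        double = solve-∀
      ... | inj₂ h = trans (isolate p r) (trans (cong (_- p) h) (ℤ.+-identityˡ (- p)))
        where
        isolate : ∀ p r → r ≡ p + r - p
        isolate = solve-∀
      four-squares : p * p + (p * p + (p * p + p * p)) ≡ + 2
      four-squares = trans (fold p) (subst (λ r → p * p + (p * p + (r * r + (r * r + 0ℤ))) ≡ + 2) r≡-p sq)
        where
        fold : ∀ p → p * p + (p * p + (p * p + p * p)) ≡ p * p + (p * p + ((- p) * (- p) + ((- p) * (- p) + 0ℤ)))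
        fold = solve-∀
      p≡0 : p ≡ 0ℤ
      p≡0 = three-squares p (square-nonneg p) (ℤ.≤-reflexive four-squares)
      absurd : p ≡ 0ℤ → ⊥
      absurd e with () ← subst (λ p → p * p + (p * p + (p * p + p * p)) ≡ + 2) e four-squares

-- Constancy on the pattern 000 makes the tail coefficients vanish. The values on 100, 010 and 001
-- are then the three leading coefficients, whose sum is the total, 0.
sparse-three-sum : ∀ {n w} {G : Vec Bool (6 ℕ.+ n) → ℤ} → w ≤ suc n → Sparse (suc w) G →
  (∀ x y → weight x ≡ suc w → weight y ≡ suc w → G (f ∷ f ∷ f ∷ x) ≡ G (f ∷ f ∷ f ∷ y)) →
  (∀ z → weight z ≡ suc w → G (f ∷ f ∷ f ∷ z) ≡ 0ℤ) ×
  (∀ z → weight z ≡ w → G (t ∷ f ∷ f ∷ z) + (G (f ∷ t ∷ f ∷ z) + G (f ∷ f ∷ t ∷ z)) ≡ 0ℤ)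
sparse-three-sum w≤ (d , G≡ , inj₁ vanish) const =
  (λ z e → G≡0 (f ∷ f ∷ f ∷ z) e) ,
  (λ z e → cong₂ _+_ (G≡0 (t ∷ f ∷ f ∷ z) (cong suc e))
    (cong₂ _+_ (G≡0 (f ∷ t ∷ f ∷ z) (cong suc e)) (G≡0 (f ∷ f ∷ t ∷ z) (cong suc e))))
  where
  G≡0 = λ y e → trans (G≡ y e) (vanish y)
sparse-three-sum {n} {w} {G} w≤ (p ∷ q ∷ r ∷ d , G≡ , inj₂ (π , e)) const = first , second
  where
  drop : ∀ p q r S → p * 0ℤ + (q * 0ℤ + (r * 0ℤ + S)) ≡ S
  drop = solve-∀

  G-tail : ∀ z → weight z ≡ suc w → G (f ∷ f ∷ f ∷ z) ≡ dot d z
  G-tail z h = trans (G≡ (f ∷ f ∷ f ∷ z) h) (drop p q r (dot d z))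

  all-squares : p * p + (q * q + (r * r + sumsq d)) ≡ + 2
  all-squares = unit-pair-sumsq (p ∷ q ∷ r ∷ d) π e

  rest : (∀ y → dot d y ≡ 0ℤ) × total d ≡ 0ℤ × sumsq d ≡ 0ℤ
  rest = dot-constant⇒zero d w≤
    (λ x y hx hy → trans (sym (G-tail x hx)) (trans (const x y hx hy) (G-tail y hy)))
    (subst (sumsq d ≤ᶻ_) all-squares (≤-square-+ p (≤-square-+ q (≤-square-+ r ℤ.≤-refl))))

  first : ∀ z → weight z ≡ suc w → G (f ∷ f ∷ f ∷ z) ≡ 0ℤ
  first z h = trans (G-tail z h) (proj₁ rest z)

  second : ∀ z → weight z ≡ w → G (t ∷ f ∷ f ∷ z) + (G (f ∷ t ∷ f ∷ z) + G (f ∷ f ∷ t ∷ z)) ≡ 0ℤ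
  second z h = trans
    (cong₂ _+_ (G≡ (t ∷ f ∷ f ∷ z) (cong suc h))
      (cong₂ _+_ (G≡ (f ∷ t ∷ f ∷ z) (cong suc h)) (G≡ (f ∷ f ∷ t ∷ z) (cong suc h))))
    (collect p q r (proj₁ rest z) (proj₁ (proj₂ rest)) (unit-pair-total (p ∷ q ∷ r ∷ d) π e))
    where
    collect : ∀ p q r {S T} → S ≡ 0ℤ → T ≡ 0ℤ → p + (q + (r + T)) ≡ 0ℤ →
      p * 1ℤ + (q * 0ℤ + (r * 0ℤ + S)) + (p * 0ℤ + (q * 1ℤ + (r * 0ℤ + S)) + (p * 0ℤ + (q * 0ℤ + (r * 1ℤ + S)))) ≡ 0ℤ
    collect p q r refl refl h = trans (ring p q r) h
      where
      ring : ∀ p q r → p * 1ℤ + (q * 0ℤ + (r * 0ℤ + 0ℤ)) + (p * 0ℤ + (q * 1ℤ + (r * 0ℤ + 0ℤ)) + (p * 0ℤ + (q * 0ℤ + (r * 1ℤ + 0ℤ))))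
        ≡ p + (q + (r + 0ℤ))
      ring = solve-∀

-- With n = 9 + m and w = 4 + v this is the condition n > 2w.
module _ {m v : ℕ} (2v≤m : 2 ℕ.* v ≤ m) where

  private
    v≤m : v ≤ m
    v≤m = ℕ.≤-trans (ℕ.m≤n*m v 2) 2v≤m

  diff-sparse : ∀ {F} → Eigen (9 ℕ.+ m) (4 ℕ.+ v) F → Sparse (3 ℕ.+ v) (diff F)
  diff-sparse {F} F-eig = normalise (diff-affine {4 ℕ.+ m} {2 ℕ.+ v} F-eig (s≤s (s≤s (ℕ.m≤n⇒m≤1+n (ℕ.m≤n⇒m≤1+n (ℕ.m≤n⇒m≤1+n v≤m))))))
    where
    normalise : ∃[ c ] ∃[ d ] (∀ y → weight y ≡ 3 ℕ.+ v → diff F y ≡ c + dot d y) ×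
        + (7 ℕ.+ m) * c ≡ - (+ (3 ℕ.+ v) * total d) →
      Sparse (3 ℕ.+ v) (diff F)
    -- The difference has `7 + m = 6 + suc m` coordinates, which makes the inequality strict.
    normalise (c , d , aff , balance) = sparse-cong aff (two-coefficients {suc m} {v} (s≤s 2v≤m) c d
      (λ y p → subst (λ s → -1ℤ ≤ᶻ s × s ≤ᶻ 1ℤ) (aff y p)
        (bit-diff-bounds (F-eig .boolean (t ∷ f ∷ y)) (F-eig .boolean (f ∷ t ∷ y)))) balance)

  -- The four leading coordinates are i, j, k, l. On the slice, `F` depends only on the trace on
  -- them.
  TailConstant : (Vec Bool (9 ℕ.+ m) → ℤ) → Set
  TailConstant F = ∀ a b c e x y → weight x ≡ weight y → weight (a ∷ b ∷ c ∷ e ∷ x) ≡ 4 ℕ.+ v →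
    F (a ∷ b ∷ c ∷ e ∷ x) ≡ F (a ∷ b ∷ c ∷ e ∷ y)

  -- The permutation moves the second coordinate to fifth place, so `diff` now exchanges i with a
  -- coordinate p outside i, j, k, l. `TailConstant` supplies the constancy for `sparse-three-sum`.
  exchange : ∀ {F} → Eigen (9 ℕ.+ m) (4 ℕ.+ v) F → TailConstant F →
    (∀ z → weight z ≡ 3 ℕ.+ v → F (t ∷ f ∷ f ∷ f ∷ f ∷ z) ≡ F (f ∷ f ∷ f ∷ f ∷ t ∷ z)) ×
    (∀ z → weight z ≡ 2 ℕ.+ v →
      (F (t ∷ t ∷ f ∷ f ∷ f ∷ z) - F (f ∷ t ∷ f ∷ f ∷ t ∷ z)) +
      ((F (t ∷ f ∷ t ∷ f ∷ f ∷ z) - F (f ∷ f ∷ t ∷ f ∷ t ∷ z)) +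
       (F (t ∷ f ∷ f ∷ t ∷ f ∷ z) - F (f ∷ f ∷ f ∷ t ∷ t ∷ z))) ≡ 0ℤ)
  exchange {F} F-eig tail = (λ z h → ℤ.i-j≡0⇒i≡j _ _ (proj₁ sums z h)) , proj₂ sums
    where
    sums = sparse-three-sum {suc m} {2 ℕ.+ v} (s≤s (s≤s v≤m))
      (diff-sparse (permute F-eig (lift (lift (lift swp) ⊙ lift swp ⊙ swp))))
      (λ x y p q → cong₂ _-_ (tail t f f f (f ∷ x) (f ∷ y) (trans p (sym q)) (cong suc p))
                             (tail f f f f (t ∷ x) (t ∷ y) (cong suc (trans p (sym q))) (cong suc p)))

  module _ {F} (F-eig : Eigen (9 ℕ.+ m) (4 ℕ.+ v) F)
           (pair : ∀ a b z → weight (a ∷ b ∷ z) ≡ 3 ℕ.+ v → diff F (a ∷ b ∷ z) ≡ val a - val b) where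

    private
      F-bit = F-eig .boolean

      -- Two bits whose difference is 1 or -1 are determined by it: this fixes `F` on the traces ik,
      -- jk and, in `F₂`, on il, jl.
      F₁ : ∀ z → weight z ≡ 2 ℕ.+ v → F (t ∷ f ∷ t ∷ f ∷ z) ≡ 1ℤ × F (f ∷ t ∷ t ∷ f ∷ z) ≡ 0ℤ
      F₁ z e = bit-diff-1 (F-bit _) (F-bit _) (pair t f z (cong suc e))

      F₂ : ∀ z → weight z ≡ 2 ℕ.+ v → F (t ∷ f ∷ f ∷ t ∷ z) ≡ 0ℤ × F (f ∷ t ∷ f ∷ t ∷ z) ≡ 1ℤ
      F₂ z e = bit-diff--1 (F-bit _) (F-bit _) (pair f t z (cong suc e))

    -- `ρ` carries the exchanged pair past i, j, k, l into the tail. On the traces ik, jk, il the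
    -- value of `F` is already fixed, so the difference vanishes there and `sparse-zero` extends
    -- this to all traces.
    tail-swap : ∀ a b c e {k x y} → Adj k x y → weight (a ∷ b ∷ c ∷ e ∷ x) ≡ 4 ℕ.+ v →
      F (a ∷ b ∷ c ∷ e ∷ x) ≡ F (a ∷ b ∷ c ∷ e ∷ y)
    tail-swap a b c e {k} adj p with z , refl , refl ← adj-split adj =
      ℤ.i-j≡0⇒i≡j _ _ (sparse-zero (ℕ.m≤n⇒m≤1+n v≤m) (diff-sparse (permute F-eig ρ))
        (λ z h → same (proj₁ (F₁ _ (wt₁ z h))) (proj₁ (F₁ _ (wt₂ z h))))
        (λ z h → same (proj₂ (F₁ _ (wt₁ z h))) (proj₂ (F₁ _ (wt₂ z h))))
        (λ z h → same (proj₁ (F₂ _ (wt₁ z h))) (proj₁ (F₂ _ (wt₂ z h))))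
        (a ∷ b ∷ c ∷ e ∷ z) (ℕ.suc-injective (trans (sym (weight-act ρ (t ∷ f ∷ a ∷ b ∷ c ∷ e ∷ z))) p)))
      where
      ρ : Perm (9 ℕ.+ m)
      ρ = lift (lift (lift (lift (toPos k)))) ⊙ lift (lift (lift rotate)) ⊙ lift (lift rotate) ⊙ lift rotate ⊙ rotate
      same : ∀ {x y u} → x ≡ u → y ≡ u → x - y ≡ 0ℤ
      same {x} refl refl = ℤ.+-inverseʳ x
      wt₁ : ∀ z → weight z ≡ suc v → weight (act (toPos k) (t ∷ f ∷ z)) ≡ 2 ℕ.+ v
      wt₁ z h = trans (weight-act (toPos k) (t ∷ f ∷ z)) (cong suc h)
      wt₂ : ∀ z → weight z ≡ suc v → weight (act (toPos k) (f ∷ t ∷ z)) ≡ 2 ℕ.+ v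
      wt₂ z h = trans (weight-act (toPos k) (f ∷ t ∷ z)) (cong suc h)

    tail-constant : TailConstant F
    tail-constant a b c e x y p q = proj₂ (connected
      (λ y → weight (a ∷ b ∷ c ∷ e ∷ y) ≡ 4 ℕ.+ v × F (a ∷ b ∷ c ∷ e ∷ x) ≡ F (a ∷ b ∷ c ∷ e ∷ y))
      (λ adj (r , h) → trans (sym (prefix adj)) r , trans h (tail-swap a b c e adj r))
      (λ adj (r , h) → trans (prefix adj) r , trans h (sym (tail-swap a b c e adj (trans (prefix adj) r))))
      x y p (q , refl))
      where
      prefix : ∀ {k x y} → Adj k x y → weight (a ∷ b ∷ c ∷ e ∷ x) ≡ weight (a ∷ b ∷ c ∷ e ∷ y)
      prefix adj = adj-weight (there a (there b (there c (there e adj))))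

    -- Since `F_j`, `F_k` and `F_l` equal `F_∅`, the three-term relation of `exchange` becomes
    -- `F_ij + 1 = 3 F_∅`, which has no solution in bits.
    not-pair : ⊥
    not-pair = impossible (F-bit x-ij) (F-bit x-∅) equation
      where
      z₃ z₂ : Vec Bool (4 ℕ.+ m)
      z₃ = proj₁ (vertex (s≤s (s≤s (s≤s (ℕ.m≤n⇒m≤1+n v≤m)))))
      z₂ = proj₁ (vertex (s≤s (s≤s (ℕ.m≤n⇒m≤1+n (ℕ.m≤n⇒m≤1+n v≤m)))))
      p₃ : weight z₃ ≡ 3 ℕ.+ v
      p₃ = proj₂ (vertex (s≤s (s≤s (s≤s (ℕ.m≤n⇒m≤1+n v≤m)))))
      p₂ : weight z₂ ≡ 2 ℕ.+ v
      p₂ = proj₂ (vertex (s≤s (s≤s (ℕ.m≤n⇒m≤1+n (ℕ.m≤n⇒m≤1+n v≤m)))))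
      x-ij x-∅ : Vec Bool (9 ℕ.+ m)
      x-ij = t ∷ t ∷ f ∷ f ∷ f ∷ z₂
      x-∅  = f ∷ f ∷ f ∷ f ∷ t ∷ z₃

      -- Relabelling puts j in the place of i; for `Fk` and `Fl` the same is done with k and l.
      Fj : F (f ∷ t ∷ f ∷ f ∷ f ∷ z₃) ≡ F x-∅
      Fj = proj₁ (exchange (permute F-eig swp) λ a b c e x y p q →
             tail-constant b a c e x y p (trans (weight-act swp (a ∷ b ∷ c ∷ e ∷ x)) q)) z₃ p₃

      Fk : F (f ∷ f ∷ t ∷ f ∷ f ∷ z₃) ≡ F x-∅
      Fk = proj₁ (exchange (permute F-eig (lift swp ⊙ swp)) λ a b c e x y p q →
             tail-constant b c a e x y p (trans (weight-act (lift swp ⊙ swp) (a ∷ b ∷ c ∷ e ∷ x)) q)) z₃ p₃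

      Fl : F (f ∷ f ∷ f ∷ t ∷ f ∷ z₃) ≡ F x-∅
      Fl = proj₁ (exchange (permute F-eig (lift (lift swp) ⊙ lift swp ⊙ swp)) λ a b c e x y p q →
             tail-constant b c e a x y p (trans (weight-act (lift (lift swp) ⊙ lift swp ⊙ swp) (a ∷ b ∷ c ∷ e ∷ x)) q)) z₃ p₃

      -- The relation of `exchange` has tail `t ∷ z₂`, while `Fj`, `Fk` and `Fl` have tail `f ∷ z₃`;
      -- equal weight allows `tail-constant` to identify them.
      same-weight : weight (t ∷ z₂) ≡ weight (f ∷ z₃)
      same-weight = trans (cong suc p₂) (sym p₃)

      equation : F x-ij - F x-∅ + (1ℤ - F x-∅ + (0ℤ - F x-∅)) ≡ 0ℤ
      equation = trans (sym (cong₂ _+_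
          (cong (λ s → F x-ij - s) (trans (tail-constant f t f f _ _ same-weight (cong (2 ℕ.+_) p₂)) Fj))
          (cong₂ _+_
            (cong₂ _-_ (proj₁ (F₁ (f ∷ z₂) p₂)) (trans (tail-constant f f t f _ _ same-weight (cong (2 ℕ.+_) p₂)) Fk))
            (cong₂ _-_ (proj₁ (F₂ (f ∷ z₂) p₂)) (trans (tail-constant f f f t _ _ same-weight (cong (2 ℕ.+_) p₂)) Fl)))))
        (proj₂ (exchange F-eig tail-constant) z₂ p₂)

      impossible : ∀ {a o} → IsBit a → IsBit o → a - o + (1ℤ - o + (0ℤ - o)) ≡ 0ℤ → ⊥
      impossible (inj₁ refl) (inj₁ refl) ()
      impossible (inj₁ refl) (inj₂ refl) ()
      impossible (inj₂ refl) (inj₁ refl) ()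
      impossible (inj₂ refl) (inj₂ refl) ()

  diff-zero : ∀ {F} → Eigen (9 ℕ.+ m) (4 ℕ.+ v) F → ∀ y → weight y ≡ 3 ℕ.+ v → diff F y ≡ 0ℤ
  diff-zero {F} F-eig y p = decide (diff-sparse F-eig)
    where
    decide : Sparse (3 ℕ.+ v) (diff F) → diff F y ≡ 0ℤ
    decide (d , F≡ , inj₁ vanish)  = trans (F≡ y p) (vanish y)
    -- The inverse of `π` brings the coefficients 1 and -1 to the places of k and l.
    decide (d , F≡ , inj₂ (π , e)) = ⊥-elim (not-pair (permute F-eig (lift (lift (inv π)))) λ a b z h → begin
      diff F (act (inv π) (a ∷ b ∷ z))                ≡⟨ F≡ _ (trans (weight-act (inv π) (a ∷ b ∷ z)) h) ⟩
      dot d (act (inv π) (a ∷ b ∷ z))                 ≡⟨ dot-inv π d (a ∷ b ∷ z) ⟩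
      dot (act π d) (a ∷ b ∷ z)                       ≡⟨ cong (λ e → dot e (a ∷ b ∷ z)) e ⟩
      1ℤ * val a + (-1ℤ * val b + dot (replicate _ 0ℤ) z) ≡⟨ cong (λ s → 1ℤ * val a + (-1ℤ * val b + s)) (dot-replicate-0 z) ⟩
      1ℤ * val a + (-1ℤ * val b + 0ℤ)                 ≡⟨ simplify (val a) (val b) ⟩
      val a - val b                                   ∎)
      where
      open ≡-Reasoning
      simplify : ∀ a b → 1ℤ * a + (-1ℤ * b + 0ℤ) ≡ a - b
      simplify = solve-∀

  eigen-constant : ∀ {F} → Eigen (9 ℕ.+ m) (4 ℕ.+ v) F →
    ∀ x y → weight x ≡ 4 ℕ.+ v → weight y ≡ 4 ℕ.+ v → F x ≡ F y
  eigen-constant {F} F-eig = slice-constant F (4 ℕ.+ v) step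
    where
    step : ∀ {k x y} → Adj k x y → weight x ≡ 4 ℕ.+ v → F x ≡ F y
    step {k} adj p with z , refl , refl ← adj-split adj = ℤ.i-j≡0⇒i≡j _ _
      (diff-zero (permute F-eig (toPos k)) z (ℕ.suc-injective (trans (sym (weight-act (toPos k) (t ∷ f ∷ z))) p)))

-- Neighbour counts as neighbour sums

keep : Bool → ℤ → ℤ
keep b a = if b then a else 0ℤ

sumAll : (Vec Bool n → ℤ) → ℤ
sumAll {zero}  F = F []
sumAll {suc n} F = sumAll (F ∘ (t ∷_)) + sumAll (F ∘ (f ∷_))

sumAll-zero : ∀ {F : Vec Bool n → ℤ} → (∀ y → F y ≡ 0ℤ) → sumAll F ≡ 0ℤ
sumAll-zero {zero}  h = h []
sumAll-zero {suc n} h = cong₂ _+_ (sumAll-zero (h ∘ (t ∷_))) (sumAll-zero (h ∘ (f ∷_)))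

-- For `x` of weight w, the pairs (w, w), (w + 1, w), (w - 1, w - 1) and (w, w - 1) for `a` and `b`
-- select `x` itself and the vectors summed by `up`, `dn` and `nb`; for the last two pairs w is
-- positive.
sumAt : ℕ → ℕ → (Vec Bool n → ℤ) → Vec Bool n → ℤ
sumAt a b F x = sumAll (λ y → keep (weight y ≡ᵇ a) (keep (common x y ≡ᵇ b) (F y)))

common≤ˡ : ∀ (x y : Vec Bool n) → common x y ≤ weight x
common≤ˡ []      []      = z≤n
common≤ˡ (t ∷ x) (t ∷ y) = s≤s (common≤ˡ x y)
common≤ˡ (t ∷ x) (f ∷ y) = ℕ.m≤n⇒m≤1+n (common≤ˡ x y)
common≤ˡ (f ∷ x) (b ∷ y) = common≤ˡ x y

common≤ʳ : ∀ (x y : Vec Bool n) → common x y ≤ weight y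
common≤ʳ []      []      = z≤n
common≤ʳ (t ∷ x) (t ∷ y) = s≤s (common≤ʳ x y)
common≤ʳ (t ∷ x) (f ∷ y) = common≤ʳ x y
common≤ʳ (f ∷ x) (t ∷ y) = ℕ.m≤n⇒m≤1+n (common≤ʳ x y)
common≤ʳ (f ∷ x) (f ∷ y) = common≤ʳ x y

keep-false : ∀ {b} a → b ≡ f → keep b a ≡ 0ℤ
keep-false a refl = refl

<⇒≡ᵇ-false : ∀ {m n} → m < n → (m ≡ᵇ n) ≡ f
<⇒≡ᵇ-false {zero}  (s≤s _)   = refl
<⇒≡ᵇ-false {suc m} (s≤s m<n) = <⇒≡ᵇ-false m<n

keep-0 : ∀ b → keep b 0ℤ ≡ 0ℤ
keep-0 t = refl
keep-0 f = refl

sumAt-zeroˡ : ∀ a b (F : Vec Bool n → ℤ) x → weight x < b → sumAt a b F x ≡ 0ℤ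
sumAt-zeroˡ a b F x lt = sumAll-zero λ y → trans
  (cong (keep (weight y ≡ᵇ a)) (keep-false (F y) (<⇒≡ᵇ-false (ℕ.≤-<-trans (common≤ˡ x y) lt))))
  (keep-0 (weight y ≡ᵇ a))

-- If a = suc a′, the left-hand side is sumAt a′ b F x.
sumAt-zeroʳ : ∀ a b (F : Vec Bool n → ℤ) x → a ≤ b →
  sumAll (λ y → keep (suc (weight y) ≡ᵇ a) (keep (common x y ≡ᵇ b) (F y))) ≡ 0ℤ
sumAt-zeroʳ a b F x a≤b = sumAll-zero λ y → vanish y (suc (weight y) ≡ᵇ a) refl
  where
  vanish : ∀ y c → (suc (weight y) ≡ᵇ a) ≡ c → keep c (keep (common x y ≡ᵇ b) (F y)) ≡ 0ℤ
  vanish y f _ = refl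
  vanish y t e = keep-false (F y) (<⇒≡ᵇ-false (ℕ.≤-<-trans (common≤ʳ x y)
    (subst (_≤ b) (sym (ℕ.≡ᵇ⇒≡ (suc (weight y)) a (subst T (sym e) _))) a≤b)))

sumAt-eq : ∀ (F : Vec Bool n → ℤ) x → sumAt (weight x) (weight x) F x ≡ F x
sumAt-eq F []      = refl
sumAt-eq F (t ∷ x) = trans
  (cong₂ _+_ (sumAt-eq (F ∘ (t ∷_)) x) (sumAt-zeroˡ (suc (weight x)) (suc (weight x)) (F ∘ (f ∷_)) x ℕ.≤-refl))
  (ℤ.+-identityʳ (F (t ∷ x)))
sumAt-eq F (f ∷ x) = trans
  (cong₂ _+_ (sumAt-zeroʳ (weight x) (weight x) (F ∘ (t ∷_)) x ℕ.≤-refl) (sumAt-eq (F ∘ (f ∷_)) x))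
  (ℤ.+-identityˡ (F (f ∷ x)))

sumAt-up : ∀ (F : Vec Bool n → ℤ) x → sumAt (suc (weight x)) (weight x) F x ≡ up F x
sumAt-up F []      = refl
sumAt-up F (t ∷ x) = trans
  (cong₂ _+_ (sumAt-up (F ∘ (t ∷_)) x) (sumAt-zeroˡ (suc (suc (weight x))) (suc (weight x)) (F ∘ (f ∷_)) x ℕ.≤-refl))
  (ℤ.+-identityʳ (up (F ∘ (t ∷_)) x))
sumAt-up F (f ∷ x) = cong₂ _+_ (sumAt-eq (F ∘ (t ∷_)) x) (sumAt-up (F ∘ (f ∷_)) x)

dn-weight-0 : ∀ (F : Vec Bool n → ℤ) x → weight x ≡ 0 → dn F x ≡ 0ℤ
dn-weight-0 F []      e = refl
dn-weight-0 F (f ∷ x) e = dn-weight-0 _ x e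

nb-weight-0 : ∀ (F : Vec Bool n → ℤ) x → weight x ≡ 0 → nb F x ≡ 0ℤ
nb-weight-0 F []      e = refl
nb-weight-0 F (f ∷ x) e = cong₂ _+_ (nb-weight-0 _ x e) (dn-weight-0 _ x e)

sumAt-dn : ∀ b (F : Vec Bool n → ℤ) x → weight x ≡ suc b → sumAt b b F x ≡ dn F x
sumAt-dn {suc n} b F (t ∷ x) e = trans
  (cong₂ _+_ (both b x (ℕ.suc-injective e))
    (subst (λ b → sumAt b b (F ∘ (f ∷_)) x ≡ F (f ∷ x)) (ℕ.suc-injective e) (sumAt-eq (F ∘ (f ∷_)) x)))
  (ℤ.+-comm (dn (F ∘ (t ∷_)) x) (F (f ∷ x)))
  where
  -- A one shared by both heads lowers the required numbers by one. At `b = 0` no vector qualifies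
  -- and both sums are zero.
  both : ∀ b x → weight x ≡ b →
    sumAll (λ y → keep (suc (weight y) ≡ᵇ b) (keep (suc (common x y) ≡ᵇ b) (F (t ∷ y)))) ≡ dn (F ∘ (t ∷_)) x
  both zero    x e = trans (sumAll-zero {n} λ _ → refl) (sym (dn-weight-0 (F ∘ (t ∷_)) x e))
  both (suc b) x e = sumAt-dn b (F ∘ (t ∷_)) x e
sumAt-dn b       F (f ∷ x) e = trans
  (cong₂ _+_ (sumAt-zeroʳ b b (F ∘ (t ∷_)) x ℕ.≤-refl) (sumAt-dn b (F ∘ (f ∷_)) x e))
  (ℤ.+-identityˡ (dn (F ∘ (f ∷_)) x))

sumAt-nb : ∀ b (F : Vec Bool n → ℤ) x → weight x ≡ suc b → sumAt (suc b) b F x ≡ nb F x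
sumAt-nb {suc n} b F (t ∷ x) e = cong₂ _+_ (both b x (ℕ.suc-injective e))
  (subst (λ b → sumAt (suc b) b (F ∘ (f ∷_)) x ≡ up (F ∘ (f ∷_)) x) (ℕ.suc-injective e) (sumAt-up (F ∘ (f ∷_)) x))
  where
  both : ∀ b x → weight x ≡ b →
    sumAll (λ y → keep (weight y ≡ᵇ b) (keep (suc (common x y) ≡ᵇ b) (F (t ∷ y)))) ≡ nb (F ∘ (t ∷_)) x
  both zero    x e = trans (sumAll-zero {n} λ y → keep-0 (weight y ≡ᵇ 0)) (sym (nb-weight-0 (F ∘ (t ∷_)) x e))
  both (suc b) x e = sumAt-nb b (F ∘ (t ∷_)) x e
sumAt-nb b F (f ∷ x) e = trans
  (cong₂ _+_ (sumAt-dn b (F ∘ (t ∷_)) x e) (sumAt-nb b (F ∘ (f ∷_)) x e))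
  (ℤ.+-comm (dn (F ∘ (t ∷_)) x) (nb (F ∘ (f ∷_)) x))

sumList : {A : Set} → (A → ℤ) → List A → ℤ
sumList g []       = 0ℤ
sumList g (y ∷ ys) = g y + sumList g ys

sumList-++ : ∀ {A : Set} (g : A → ℤ) xs ys → sumList g (xs ++ ys) ≡ sumList g xs + sumList g ys
sumList-++ g []       ys = sym (ℤ.+-identityˡ (sumList g ys))
sumList-++ g (x ∷ xs) ys = trans (cong (λ s → g x + s) (sumList-++ g xs ys)) (sym (ℤ.+-assoc (g x) (sumList g xs) (sumList g ys)))

sumList-map : ∀ {A B : Set} (g : B → ℤ) (h : A → B) xs → sumList g (List.map h xs) ≡ sumList (g ∘ h) xs
sumList-map g h []       = refl
sumList-map g h (x ∷ xs) = cong (λ s → g (h x) + s) (sumList-map g h xs)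

sumList-filter : ∀ {A : Set} {P : A → Set} (P? : ∀ y → Dec (P y)) (g : A → ℤ) xs →
  sumList g (filter P? xs) ≡ sumList (λ y → keep (does (P? y)) (g y)) xs
sumList-filter P? g []       = refl
sumList-filter P? g (x ∷ xs) with does (P? x)
... | t = cong (λ s → g x + s) (sumList-filter P? g xs)
... | f = trans (sumList-filter P? g xs) (sym (ℤ.+-identityˡ _))

length-sumList : ∀ {A : Set} (xs : List A) → + length xs ≡ sumList (λ _ → 1ℤ) xs
length-sumList []       = refl
length-sumList (x ∷ xs) = cong (λ s → 1ℤ + s) (length-sumList xs)

sumList-allVecs : ∀ n (g : Vec Bool n → ℤ) → sumList g (allVecs n) ≡ sumAll g
sumList-allVecs zero    g = ℤ.+-identityʳ (g [])
sumList-allVecs (suc n) g = trans (sumList-++ g (List.map (t ∷_) (allVecs n)) (List.map (f ∷_) (allVecs n)))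
  (cong₂ _+_ (trans (sumList-map g (t ∷_) (allVecs n)) (sumList-allVecs n (g ∘ (t ∷_))))
             (trans (sumList-map g (f ∷_) (allVecs n)) (sumList-allVecs n (g ∘ (f ∷_)))))

sumAll-cong : ∀ {F G : Vec Bool n → ℤ} → (∀ y → F y ≡ G y) → sumAll F ≡ sumAll G
sumAll-cong {zero}  h = h []
sumAll-cong {suc n} h = cong₂ _+_ (sumAll-cong (h ∘ (t ∷_))) (sumAll-cong (h ∘ (f ∷_)))

nbrsIn-nb : ∀ n w c x → weight x ≡ suc w → + nbrsIn n (suc w) c true x ≡ nb (val ∘ c) x
nbrsIn-nb n w c x e = begin
  + nbrsIn n (suc w) c true x
    ≡⟨ length-sumList (filter W? (filter C? (filter B? (allVecs n)))) ⟩
  sumList (λ _ → 1ℤ) (filter W? (filter C? (filter B? (allVecs n))))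
    ≡⟨ sumList-filter W? (λ _ → 1ℤ) (filter C? (filter B? (allVecs n))) ⟩
  sumList (λ y → keep (does (W? y)) 1ℤ) (filter C? (filter B? (allVecs n)))
    ≡⟨ sumList-filter C? (λ y → keep (does (W? y)) 1ℤ) (filter B? (allVecs n)) ⟩
  sumList (λ y → keep (does (C? y)) (keep (does (W? y)) 1ℤ)) (filter B? (allVecs n))
    ≡⟨ sumList-filter B? (λ y → keep (does (C? y)) (keep (does (W? y)) 1ℤ)) (allVecs n) ⟩
  sumList (λ y → keep (does (B? y)) (keep (does (C? y)) (keep (does (W? y)) 1ℤ))) (allVecs n)
    ≡⟨ sumList-allVecs n (λ y → keep (does (B? y)) (keep (does (C? y)) (keep (does (W? y)) 1ℤ))) ⟩
  sumAll (λ y → keep (does (B? y)) (keep (does (C? y)) (keep (does (W? y)) 1ℤ)))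
    -- The colour filter turns into the summand `val (c y)`, and the weight test moves outermost as
    -- in `sumAt`.
    ≡⟨ sumAll-cong (λ y → reorder (c y) (does (C? y)) (does (W? y))) ⟩
  sumAt (suc w) w (val ∘ c) x
    ≡⟨ sumAt-nb w (val ∘ c) x e ⟩
  nb (val ∘ c) x ∎
  where
  open ≡-Reasoning
  W? = λ (y : Vec Bool n) → weight y ≟ suc w
  C? = λ (y : Vec Bool n) → common x y ≟ w
  B? = λ (y : Vec Bool n) → c y Data.Bool.≟ true
  reorder : ∀ b p q → keep (does (b Data.Bool.≟ true)) (keep p (keep q 1ℤ)) ≡ keep q (keep p (val b))
  reorder t t t = refl
  reorder t t f = refl
  reorder t f t = refl
  reorder t f f = refl
  reorder f t t = refl
  reorder f t f = refl
  reorder f f t = refl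
  reorder f f f = refl

-- Equitable partitions as bit-valued eigenfunctions

equitable⇒eigen : ∀ n w b c → IsEquitable n (suc w) c
    (+ suc w * (+ n - + suc w) - + b) (+ b) (+ 2 * + n - + 2 - + b) (+ suc w * (+ n - + suc w) - + 2 * + n + + 2 + + b) →
  Eigen n (suc w) (val ∘ c)
equitable⇒eigen n w b c (_ , eq₁ , eq₂) = record
  { boolean = λ x → bit (c x)
  ; shift   = + 2 * + n - + 2 - + b
  ; eigen   = λ x p → trans (sym (nbrsIn-nb n w c x p)) (by-colour x p (c x) refl)
  }
  where
  bit : ∀ b → IsBit (val b)
  bit t = inj₂ refl
  bit f = inj₁ refl
  -- The eigenvalue is `s₁₁ - s₂₁` and the shift is `s₂₁`, so one affine formula in the colour bit
  -- covers both rows.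
  row₁ : ∀ w n b → w * (n - w) - b ≡ (w * (n - w) - + 2 * n + + 2) * 1ℤ + (+ 2 * n - + 2 - b)
  row₁ = solve-∀
  row₂ : ∀ w n b → + 2 * n - + 2 - b ≡ (w * (n - w) - + 2 * n + + 2) * 0ℤ + (+ 2 * n - + 2 - b)
  row₂ = solve-∀
  by-colour : ∀ x → weight x ≡ suc w → ∀ b′ → c x ≡ b′ →
    + nbrsIn n (suc w) c true x ≡ second-eigenvalue n (suc w) * val (c x) + (+ 2 * + n - + 2 - + b)
  by-colour x p t e = trans (proj₁ (eq₁ x p e)) (trans (row₁ (+ suc w) (+ n) (+ b))
    (cong (λ b′ → second-eigenvalue n (suc w) * val b′ + (+ 2 * + n - + 2 - + b)) (sym e)))
  by-colour x p f e = trans (proj₁ (eq₂ x p e)) (trans (row₂ (+ suc w) (+ n) (+ b))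
    (cong (λ b′ → second-eigenvalue n (suc w) * val b′ + (+ 2 * + n - + 2 - + b)) (sym e)))

theorem2 : (n w b : ℕ) → 3 < w → 2 Data.Nat.* w < n → n ∸ 1 ≤ b → b ≤ 2 Data.Nat.* n ∸ 1 →
    (c : Vec Bool n → Bool) →
    ¬ IsEquitable n w c
    ((+ w) * (+ n - + w) - + b)
    (+ b)
    (+ 2 * + n - + 2 - + b)
    ((+ w) * (+ n - + w) - + 2 * + n + + 2 + + b)
theorem2 n (suc (suc (suc (suc v)))) b (s≤s (s≤s (s≤s (s≤s z≤n)))) 2w<n _ _ c equitable =
  -- For w = 4 + v the inequality 2w < n reads `9 + 2 * v ≤ n`. With surplus `o` this gives
  -- `m = 2 * v + o`.
  monochromatic (ℕ.m≤n⇒∃[o]m+o≡n (subst (_≤ n) (cong suc (ℕ.*-distribˡ-+ 2 4 v)) 2w<n)) c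
    (equitable⇒eigen n (3 ℕ.+ v) b c equitable) (proj₁ equitable)
  where
  monochromatic : ∀ {n} → (∃[ o ] 9 ℕ.+ 2 ℕ.* v ℕ.+ o ≡ n) → ∀ c →
    Eigen n (4 ℕ.+ v) (val ∘ c) → IsTwoPartition n (4 ℕ.+ v) c → ⊥
  monochromatic (o , refl) c eig ((x , p , cx) , (y , q , cy))
    -- Both classes are nonempty, so a constant indicator would force `1 = 0`.
    with () ← trans (sym (cong val cx)) (trans (eigen-constant (ℕ.m≤m+n (2 ℕ.* v) o) eig x y p q) (cong val cy))
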